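{- Let $p$ be a prime, $p>3$, and let $t\in D_p$. Then modulo $p$: \begin{align*} \sum_{k=0}^{p-1}C_{2k}\left(\frac{1-t^2}{16}\right)^k&\equiv \frac{1}{2}\left(\frac{2}{p}\right)\left(\left(\frac{1-t}{p}\right)(1-t)+\left(\frac{1+t}{p}\right)(1+t)\right),\\ \sum_{k=0}^{p-1}\binom{4k}{2k}t^{2k}&\equiv\frac{1}{2}\left(\left(\frac{1-4t}{p}\right)(1+2t)+\left(\frac{1+4t}{p}\right)(1-2t)\right). \end{align*}
   Context: $C_n=\frac{1}{n+1}\binom{2n}{n}$ are the Catalan numbers. $D_p$ is the set of rationals whose denominator is not divisible by $p$; congruences between elements of $D_p$ are in the usual sense. For $c=a/b\in D_p$ in lowest terms, $\left(\frac{c}{p}\right)=\left(\frac{ab}{p}\right)$ (Legendre symbol), which is $0$ if $p\mid a$. -}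

module Defs where

open import Data.Bool using (Bool; true; false; if_then_else_)
open import Data.Nat as ℕ using (ℕ; zero; suc; NonZero; _≡ᵇ_)
open import Data.Nat.Combinatorics using (_C_)
open import Data.Nat.DivMod using (_%_)
open import Data.Nat.Divisibility using (_∣_)
open import Data.Integer as ℤ using (ℤ; +_; -[1+_])
open import Data.Integer.DivMod using (_%ℕ_)
open import Data.List using (List; upTo)
open import Data.Bool.ListAction using (any)
open import Data.Rational as ℚ using (ℚ; _+_; _-_; _*_; 0ℚ; 1ℚ; _/_)
open import Relation.Nullary using (¬_)

catalan : ℕ → ℚ
catalan n = (+ ((2 ℕ.* n) C n)) / suc n

_^ℚ_ : ℚ → ℕ → ℚ
x ^ℚ zero = 1ℚ
x ^ℚ suc k = x * (x ^ℚ k)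

sumℚ : ℕ → (ℕ → ℚ) → ℚ
sumℚ zero f = 0ℚ
sumℚ (suc n) f = sumℚ n f + f n

InD : ℕ → ℚ → Set
InD p c = ¬ (p ∣ ℚ.denominatorℕ c)

-- congruence a ≡ b (mod p) for a, b ∈ D_p : p divides the numerator of a - b
infix 4 _≡_[modℚ_]
_≡_[modℚ_] : ℚ → ℚ → ℕ → Set
a ≡ b [modℚ p ] = p ∣ ℤ.∣ ℚ.numerator (a - b) ∣

legendreℤ : ℤ → (p : ℕ) → .{{_ : NonZero p}} → ℤ
legendreℤ n p with n %ℕ p
... | zero = + 0
... | r@(suc _) =
  if any (λ x → ((x ℕ.* x) % p) ≡ᵇ r) (upTo p) then + 1 else -[1+ 0 ]

legendreℚ : ℚ → (p : ℕ) → .{{_ : NonZero p}} → ℚ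
legendreℚ c p = ℚ._/_ (legendreℤ (ℚ.numerator c ℤ.* ℚ.denominator c) p) 1

{-# OPTIONS --safe #-}

-- Let p = 2n + 1 and bₘ = C(2m, m).  Modulo p the recurrence (m + 1) bₘ₊₁ = 2 (2m + 1) bₘ is also that of
-- (-4)^m C(n, m), and b_{p+i} ≡ 2 bᵢ, so F(x) = ∑_{m<2p} bₘ x^m = (1 + 2 x^p) (1 - 4 x)^n.  Taking even parts gives
-- the second congruence, by Fermat's little theorem and Euler's criterion.
--
-- For the first one, 2 Cₘ = 4 bₘ - bₘ₊₁ expresses the Catalan sum at x = s² by F(s) and F(-s).  Adjoin square roots
-- a and b of 1 + t and 1 - t and take s = ab / 4: then 2 (1 ± 4 s) = (a ± b)², so the Frobenius endomorphism evaluates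
-- (1 ± 4 s)^{n+1}, and comparing the coefficients of ab gives the claim in the ground field.
module Submission where

open import Defs
open import Algebra.Bundles using (CommutativeRing)
import Algebra.Morphism.Construct.Composition
open import Algebra.Morphism.Structures using (IsRingHomomorphism)
import Algebra.Properties.AbelianGroup
import Algebra.Properties.CommutativeSemiring.Binomial
import Algebra.Properties.CommutativeSemiring.Exp
import Algebra.Properties.Group
import Algebra.Properties.Ring
import Algebra.Properties.Semiring.Mult
import Algebra.Properties.Semiring.Mult.TCOptimised
import Algebra.Properties.Semiring.Sum
import Algebra.Solver.Ring
open import Algebra.Solver.Ring.AlmostCommutativeRing using (fromCommutativeRing; _-Raw-AlmostCommutative⟶_; Induced-equivalence)
open import Data.Bool using (true; false; T)
open import Data.Bool.ListAction using (any)
open import Data.Fin as Fin using (toℕ; fromℕ; inject₁)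
import Data.Fin.Properties as Fin
open import Data.Integer as ℤ using (ℤ; +_; -[1+_])
open import Data.Integer.DivMod as ℤ using (_%ℕ_)
open import Data.Integer.Divisibility.Signed as ℤ∣ using (∣m∣n⇒∣m+n; ∣m⇒∣-m; ∣n⇒∣m*n) renaming (_∣_ to _∣ℤ_)
import Data.Integer.Properties as ℤ
open import Data.Integer.Solver using (module +-*-Solver)
open import Data.List using (List; []; _∷_; length; applyUpTo; upTo; replicate)
open import Data.List.Membership.Propositional using (_∈_; find; lose)
open import Data.List.Membership.Propositional.Properties using (∈-upTo⁺)
open import Data.List.Properties using (length-applyUpTo; length-replicate)
open import Data.List.Relation.Unary.All as All using (All; []; _∷_)
import Data.List.Relation.Unary.All.Properties as All
open import Data.List.Relation.Unary.AllPairs using (AllPairs; []; _∷_)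
import Data.List.Relation.Unary.AllPairs.Properties as AllPairs
open import Data.List.Relation.Unary.Any.Properties using (any⁺; any⁻)
open import Data.Maybe using (just; nothing)
open import Data.Nat as ℕ using (ℕ; zero; suc; _<_; _>_; _≤_; s≤s; z≤n; NonZero)
open import Data.Nat.Combinatorics using (_C_; nC1≡n; nCn≡1; nCk≡nC[n∸k]; nCk+nC[k+1]≡[n+1]C[k+1])
open import Data.Nat.Combinatorics.Specification using (k>n⇒nCk≡0)
open import Data.Nat.Coprimality as Coprimality using (Coprime; prime⇒coprime; coprime-Bézout; coprime-divisor)
import Data.Nat.DivMod as ℕ
open import Data.Nat.Divisibility using (_∣_; divides; m∣m*n; >⇒∤; m%n≡0⇒n∣m)
open import Data.Nat.GCD using (module Bézout)
open import Data.Nat.Primality using (Prime; ¬prime[0]; ¬prime[1]; euclidsLemma; prime⇒nonTrivial; prime⇒irreducible)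
import Data.Nat.Properties as ℕ
open import Data.Product using (_×_; _,_; proj₁; proj₂; ∃)
open import Data.Rational as ℚ using (ℚ; mkℚ; toℚᵘ; 1ℚ)
open import Data.Rational.Properties using (toℚᵘ-homo-+; toℚᵘ-homo-*; toℚᵘ-homo‿-; toℚᵘ-fromℚᵘ)
open import Data.Rational.Unnormalised using (mkℚᵘ; _≃_; *≡*)
import Data.Rational.Unnormalised.Properties as ℚᵘ
open import Data.Sum using (_⊎_; inj₁; inj₂; [_,_]′)
import Level
open import Relation.Binary.Definitions using (WeaklyDecidable)
open import Relation.Binary.PropositionalEquality as ≡ using (_≡_)
import Relation.Binary.Reasoning.Setoid
open import Relation.Nullary using (¬_; yes; no; contradiction)

-- The obstacle in the first congruence is that s need not lie in the prime field, so Fermat's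
-- theorem does not give s^p. Over the adjoined roots only a^p = a (1 + t)^n and b^p = b (1 - t)^n
-- are needed. The roots are adjoined formally, even if 1 + t or 1 - t is already a square or is 0.
-- The ring obtained is then not a field, but no case distinction arises: the facts about binomial
-- coefficients, Frobenius and F are proved in every commutative ring with p = 0. Integrality,
-- Fermat and Euler's criterion are used in the ground field alone. In such a ring s cannot be
-- divided out (for t = 1 or t = -1 it squares to 0). The identity for the Catalan sum is therefore
-- proved with a factor ab on both sides. Removing it is legitimate because 1, a, b, ab form a basis
-- over the ground field, so a multiple of ab by a ground element determines that element.

-- Integers in a commutative ring, and a ring solver with integer coefficients.

module IntegerCoefficients {c ℓ} (R : CommutativeRing c ℓ) where

  open CommutativeRing R
  open Algebra.Properties.Ring ring using (-‿distribˡ-*; -‿distribʳ-*; -0#≈0#; -‿involutive)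
  open Algebra.Properties.AbelianGroup +-abelianGroup using (⁻¹-∙-comm)
  open Algebra.Properties.Semiring.Mult.TCOptimised semiring using (1+×; ×-homo-+; ×1-homo-*) renaming (_×_ to _×′_)
  open Relation.Binary.Reasoning.Setoid setoid

  -- With the multiples `×′`, `ι (+ 1)` computes to `1#` and `ι -[1+ 3 ]` to `- ι (+ 4)`; later
  -- steps rely on both.
  ι : ℤ → Carrier
  ι (+ n)    = n ×′ 1#
  ι -[1+ n ] = - (suc n ×′ 1#)

  ι-cong : ∀ {i j} → i ≡ j → ι i ≈ ι j
  ι-cong ≡.refl = refl

  ι-homo-⊖ : ∀ m n → ι (m ℤ.⊖ n) ≈ m ×′ 1# - n ×′ 1#
  ι-homo-⊖ m       zero    = sym (trans (+-congˡ -0#≈0#) (+-identityʳ _))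
  ι-homo-⊖ zero    (suc n) = sym (+-identityˡ _)
  ι-homo-⊖ (suc m) (suc n) = begin
    ι (suc m ℤ.⊖ suc n)               ≡⟨ ≡.cong ι (ℤ.[1+m]⊖[1+n]≡m⊖n m n) ⟩
    ι (m ℤ.⊖ n)                       ≈⟨ ι-homo-⊖ m n ⟩
    x - y                             ≈⟨ +-congʳ (+-identityˡ x) ⟨
    (0# + x) - y                      ≈⟨ +-congʳ (+-congʳ (-‿inverseʳ 1#)) ⟨
    ((1# - 1#) + x) - y               ≈⟨ +-congʳ (+-assoc 1# (- 1#) x) ⟩
    (1# + (- 1# + x)) - y             ≈⟨ +-congʳ (+-congˡ (+-comm (- 1#) x)) ⟩
    (1# + (x - 1#)) - y               ≈⟨ +-congʳ (+-assoc 1# x (- 1#)) ⟨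
    ((1# + x) - 1#) - y               ≈⟨ +-assoc (1# + x) (- 1#) (- y) ⟩
    (1# + x) + (- 1# - y)             ≈⟨ +-cong (sym (1+× m 1#)) (trans (⁻¹-∙-comm 1# y) (-‿cong (sym (1+× n 1#)))) ⟩
    suc m ×′ 1# - suc n ×′ 1#         ∎
    where x = m ×′ 1# ; y = n ×′ 1#

  ι-homo-neg : ∀ i → ι (ℤ.- i) ≈ - ι i
  ι-homo-neg (+ zero)  = sym -0#≈0#
  ι-homo-neg (+ suc n) = refl
  ι-homo-neg -[1+ n ]  = sym (-‿involutive _)

  ι-homo-+ : ∀ i j → ι (i ℤ.+ j) ≈ ι i + ι j
  ι-homo-+ (+ m)    (+ n)    = ×-homo-+ 1# m n
  ι-homo-+ (+ m)    -[1+ n ] = ι-homo-⊖ m (suc n)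
  ι-homo-+ -[1+ m ] (+ n)    = trans (ι-homo-⊖ n (suc m)) (+-comm _ _)
  ι-homo-+ -[1+ m ] -[1+ n ] = begin
    - (suc (suc (m ℕ.+ n)) ×′ 1#)        ≡⟨ ≡.cong (λ k → - (suc k ×′ 1#)) (ℕ.+-suc m n) ⟨
    - ((suc m ℕ.+ suc n) ×′ 1#)          ≈⟨ -‿cong (×-homo-+ 1# (suc m) (suc n)) ⟩
    - (suc m ×′ 1# + suc n ×′ 1#)        ≈⟨ ⁻¹-∙-comm _ _ ⟨
    - (suc m ×′ 1#) - (suc n ×′ 1#)      ∎

  private
    ι-homo-*-pos : ∀ m j → ι (+ m ℤ.* j) ≈ ι (+ m) * ι j
    ι-homo-*-pos m (+ n)    = begin
      ι (+ m ℤ.* + n)           ≡⟨ ≡.cong ι (ℤ.pos-* m n) ⟨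
      (m ℕ.* n) ×′ 1#           ≈⟨ ×1-homo-* m n ⟩
      (m ×′ 1#) * (n ×′ 1#)     ∎
    ι-homo-*-pos m -[1+ n ] = begin
      ι (+ m ℤ.* -[1+ n ])          ≡⟨ ≡.cong ι (ℤ.neg-distribʳ-* (+ m) (+ suc n)) ⟨
      ι (ℤ.- (+ m ℤ.* + suc n))     ≈⟨ ι-homo-neg (+ m ℤ.* + suc n) ⟩
      - ι (+ m ℤ.* + suc n)         ≈⟨ -‿cong (ι-homo-*-pos m (+ suc n)) ⟩
      - (ι (+ m) * ι (+ suc n))     ≈⟨ -‿distribʳ-* _ _ ⟩
      ι (+ m) * - ι (+ suc n)       ∎

  ι-homo-* : ∀ i j → ι (i ℤ.* j) ≈ ι i * ι j
  ι-homo-* (+ m)    j = ι-homo-*-pos m j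
  ι-homo-* -[1+ m ] j = begin
    ι (-[1+ m ] ℤ.* j)         ≡⟨ ≡.cong ι (ℤ.neg-distribˡ-* (+ suc m) j) ⟨
    ι (ℤ.- (+ suc m ℤ.* j))    ≈⟨ ι-homo-neg (+ suc m ℤ.* j) ⟩
    - ι (+ suc m ℤ.* j)        ≈⟨ -‿cong (ι-homo-*-pos (suc m) j) ⟩
    - (ι (+ suc m) * ι j)      ≈⟨ -‿distribˡ-* _ _ ⟩
    - ι (+ suc m) * ι j        ∎

  ι-morphism : ℤ.+-*-rawRing -Raw-AlmostCommutative⟶ fromCommutativeRing R
  ι-morphism = record
    { ⟦_⟧ = ι ; +-homo = ι-homo-+ ; *-homo = ι-homo-* ; -‿homo = ι-homo-neg ; 0-homo = refl ; 1-homo = refl }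

  -- Equality in `R` is not assumed decidable, so coefficients are compared as integers. The solver
  -- proves identities valid over ℤ; facts such as p ≈ 0 or 2h ≈ 1 enter as separate steps.
  ι-≟ : WeaklyDecidable (Induced-equivalence ι-morphism)
  ι-≟ i j with i ℤ.≟ j
  ... | yes i≡j = just (ι-cong i≡j)
  ... | no  _   = nothing

  open Algebra.Solver.Ring ℤ.+-*-rawRing (fromCommutativeRing R) ι-morphism ι-≟ public
    using (solve; _:=_; _:+_; _:*_; _:-_; :-_; _:^_; con)

-- The free quadratic extension of a commutative ring.

module QuadraticExtension {c ℓ} (R : CommutativeRing c ℓ) (d : CommutativeRing.Carrier R) where

  open CommutativeRing R
  open IntegerCoefficients R using (solve; _:=_; _:+_; _:*_; :-_; con)

  -- This is R[X]/(X² - d), the pair (u, v) standing for u + v √d. Nothing is required of `d`, so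
  -- zero divisors may appear.
  extension : CommutativeRing c ℓ
  extension = record
    { Carrier = Carrier × Carrier
    ; _≈_ = λ x y → (proj₁ x ≈ proj₁ y) × (proj₂ x ≈ proj₂ y)
    ; _+_ = λ x y → (proj₁ x + proj₁ y) , (proj₂ x + proj₂ y)
    ; _*_ = λ x y → (proj₁ x * proj₁ y + d * (proj₂ x * proj₂ y)) , (proj₁ x * proj₂ y + proj₂ x * proj₁ y)
    ; -_ = λ x → (- proj₁ x) , (- proj₂ x)
    ; 0# = 0# , 0#
    ; 1# = 1# , 0#
    ; isCommutativeRing = record
      { isRing = record
        { +-isAbelianGroup = record
          { isGroup = record
            { isMonoid = record
              { isSemigroup = record
                { isMagma = record
                  { isEquivalence = record
                    { refl = refl , refl
                    ; sym = λ (p , q) → sym p , sym q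
                    ; trans = λ (p , q) (p′ , q′) → trans p p′ , trans q q′ }
                  ; ∙-cong = λ (p , q) (p′ , q′) → +-cong p p′ , +-cong q q′ }
                ; assoc = λ _ _ _ → +-assoc _ _ _ , +-assoc _ _ _ }
              ; identity = (λ _ → +-identityˡ _ , +-identityˡ _) , (λ _ → +-identityʳ _ , +-identityʳ _) }
            ; inverse = (λ _ → -‿inverseˡ _ , -‿inverseˡ _) , (λ _ → -‿inverseʳ _ , -‿inverseʳ _)
            ; ⁻¹-cong = λ (p , q) → -‿cong p , -‿cong q }
          ; comm = λ _ _ → +-comm _ _ , +-comm _ _ }
        ; *-cong = λ (p , q) (p′ , q′) → +-cong (*-cong p p′) (*-congˡ (*-cong q q′)) , +-cong (*-cong p q′) (*-cong q p′)
        ; *-assoc = λ (a , b) (a′ , b′) (a″ , b″) →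
            solve 7 (λ d a b a′ b′ a″ b″ →
              (a :* a′ :+ d :* (b :* b′)) :* a″ :+ d :* ((a :* b′ :+ b :* a′) :* b″)
              := a :* (a′ :* a″ :+ d :* (b′ :* b″)) :+ d :* (b :* (a′ :* b″ :+ b′ :* a″))) refl d a b a′ b′ a″ b″
          , solve 7 (λ d a b a′ b′ a″ b″ →
              (a :* a′ :+ d :* (b :* b′)) :* b″ :+ (a :* b′ :+ b :* a′) :* a″
              := a :* (a′ :* b″ :+ b′ :* a″) :+ b :* (a′ :* a″ :+ d :* (b′ :* b″))) refl d a b a′ b′ a″ b″
        ; *-identity =
            (λ (a , b) → solve 3 (λ d a b → con (+ 1) :* a :+ d :* (con (+ 0) :* b) := a) refl d a b
                       , solve 2 (λ a b → con (+ 1) :* b :+ con (+ 0) :* a := b) refl a b)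
          , (λ (a , b) → solve 3 (λ d a b → a :* con (+ 1) :+ d :* (b :* con (+ 0)) := a) refl d a b
                       , solve 2 (λ a b → a :* con (+ 0) :+ b :* con (+ 1) := b) refl a b)
        ; distrib =
            (λ (a , b) (a′ , b′) (a″ , b″) →
              solve 7 (λ d a b a′ b′ a″ b″ →
                a :* (a′ :+ a″) :+ d :* (b :* (b′ :+ b″))
                := (a :* a′ :+ d :* (b :* b′)) :+ (a :* a″ :+ d :* (b :* b″))) refl d a b a′ b′ a″ b″
            , solve 6 (λ a b a′ b′ a″ b″ →
                a :* (b′ :+ b″) :+ b :* (a′ :+ a″)
                := (a :* b′ :+ b :* a′) :+ (a :* b″ :+ b :* a″)) refl a b a′ b′ a″ b″)
          , (λ (a , b) (a′ , b′) (a″ , b″) →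
              solve 7 (λ d a b a′ b′ a″ b″ →
                (a′ :+ a″) :* a :+ d :* ((b′ :+ b″) :* b)
                := (a′ :* a :+ d :* (b′ :* b)) :+ (a″ :* a :+ d :* (b″ :* b))) refl d a b a′ b′ a″ b″
            , solve 6 (λ a b a′ b′ a″ b″ →
                (a′ :+ a″) :* b :+ (b′ :+ b″) :* a
                := (a′ :* b :+ b′ :* a) :+ (a″ :* b :+ b″ :* a)) refl a b a′ b′ a″ b″) }
      ; *-comm = λ (a , b) (a′ , b′) →
            solve 5 (λ d a b a′ b′ → a :* a′ :+ d :* (b :* b′) := a′ :* a :+ d :* (b′ :* b)) refl d a b a′ b′
          , solve 4 (λ a b a′ b′ → a :* b′ :+ b :* a′ := a′ :* b :+ b′ :* a) refl a b a′ b′ } }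

  private module E = CommutativeRing extension

  embed : Carrier → E.Carrier
  embed x = x , 0#

  √d : E.Carrier
  √d = 0# , 1#

  √d*√d≈d : √d E.* √d E.≈ embed d
  √d*√d≈d = solve 1 (λ d → con (+ 0) :* con (+ 0) :+ d :* (con (+ 1) :* con (+ 1)) := d) refl d
          , solve 0 (con (+ 0) :* con (+ 1) :+ con (+ 1) :* con (+ 0) := con (+ 0)) refl

  -- Multiplication by √d carries the first coordinate unchanged into the second. This is what later
  -- replaces division by √d, and it works even for d = 0.
  √d*x : ∀ x → proj₂ (√d E.* x) ≈ proj₁ x
  √d*x (a , b) = solve 2 (λ a b → con (+ 0) :* b :+ con (+ 1) :* a := a) refl a b

  embed-isRingHomomorphism : IsRingHomomorphism rawRing E.rawRing embed
  embed-isRingHomomorphism = record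
    { isSemiringHomomorphism = record
      { isNearSemiringHomomorphism = record
        { +-isMonoidHomomorphism = record
          { isMagmaHomomorphism = record
            { isRelHomomorphism = record { cong = λ x≈y → x≈y , refl }
            ; homo = λ x y → refl , sym (+-identityˡ 0#) }
          ; ε-homo = E.refl }
        ; *-homo = λ x y →
              solve 3 (λ d x y → x :* y := x :* y :+ d :* (con (+ 0) :* con (+ 0))) refl d x y
            , solve 2 (λ x y → con (+ 0) := x :* con (+ 0) :+ con (+ 0) :* y) refl x y }
      ; 1#-homo = E.refl }
    ; -‿homo = λ x → refl , solve 0 (con (+ 0) := :- con (+ 0)) refl }

-- Binomial coefficients over the natural numbers.

-- Pascal's rule and induction on the row. Being free of division, it survives reduction modulo p;
-- the ratio recurrences below and the divisibility of `p C k` all come from it.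
absorption : ∀ n k → suc k ℕ.* (suc n C suc k) ≡ suc n ℕ.* (n C k)
absorption n       zero    = ≡.trans (ℕ.*-identityˡ _) (≡.trans (nC1≡n (suc n)) (≡.sym (ℕ.*-identityʳ (suc n))))
absorption zero    (suc k) = ≡.trans (≡.cong (suc (suc k) ℕ.*_) (k>n⇒nCk≡0 {1} {suc (suc k)} (s≤s (s≤s z≤n)))) (ℕ.*-zeroʳ k)
absorption (suc n) (suc k) = begin
  (2 ℕ.+ k) ℕ.* (suc (suc n) C suc (suc k))
    ≡⟨ ≡.cong ((2 ℕ.+ k) ℕ.*_) (nCk+nC[k+1]≡[n+1]C[k+1] (suc n) (suc k)) ⟨
  (2 ℕ.+ k) ℕ.* (x ℕ.+ (suc n C suc (suc k)))
    ≡⟨ ℕ.*-distribˡ-+ (2 ℕ.+ k) x _ ⟩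
  x ℕ.+ suc k ℕ.* x ℕ.+ (2 ℕ.+ k) ℕ.* (suc n C suc (suc k))
    ≡⟨ ≡.cong₂ (λ u v → x ℕ.+ u ℕ.+ v) (absorption n k) (absorption n (suc k)) ⟩
  x ℕ.+ suc n ℕ.* (n C k) ℕ.+ suc n ℕ.* (n C suc k)
    ≡⟨ ℕ.+-assoc x _ _ ⟩
  x ℕ.+ (suc n ℕ.* (n C k) ℕ.+ suc n ℕ.* (n C suc k))
    ≡⟨ ≡.cong (x ℕ.+_) (ℕ.*-distribˡ-+ (suc n) (n C k) (n C suc k)) ⟨
  x ℕ.+ suc n ℕ.* ((n C k) ℕ.+ (n C suc k))
    ≡⟨ ≡.cong (λ u → x ℕ.+ suc n ℕ.* u) (nCk+nC[k+1]≡[n+1]C[k+1] n k) ⟩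
  x ℕ.+ suc n ℕ.* x ∎
  where
  open ≡.≡-Reasoning
  x = suc n C suc k

central : ℕ → ℕ
central m = (2 ℕ.* m) C m

2*suc : ∀ m → 2 ℕ.* suc m ≡ suc (suc (2 ℕ.* m))
2*suc m = ℕ.*-suc 2 m

[1+2m]C[1+m]≡[1+2m]Cm : ∀ m → suc (2 ℕ.* m) C suc m ≡ suc (2 ℕ.* m) C m
[1+2m]C[1+m]≡[1+2m]Cm m = ≡.trans (nCk≡nC[n∸k] (s≤s (ℕ.m≤m+n m _)))
  (≡.cong (suc (2 ℕ.* m) C_) (≡.trans (ℕ.m+n∸m≡n m (m ℕ.+ 0)) (ℕ.+-identityʳ m)))

central-suc : ∀ m → central (suc m) ≡ 2 ℕ.* (suc (2 ℕ.* m) C m)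
central-suc m = begin
  (2 ℕ.* suc m) C suc m                      ≡⟨ ≡.cong (_C suc m) (2*suc m) ⟩
  suc (suc (2 ℕ.* m)) C suc m                ≡⟨ nCk+nC[k+1]≡[n+1]C[k+1] (suc (2 ℕ.* m)) m ⟨
  x ℕ.+ (suc (2 ℕ.* m) C suc m)              ≡⟨ ≡.cong (x ℕ.+_) ([1+2m]C[1+m]≡[1+2m]Cm m) ⟩
  x ℕ.+ x                                    ≡⟨ ≡.cong (x ℕ.+_) (ℕ.+-identityʳ x) ⟨
  2 ℕ.* x                                    ∎
  where
  open ≡.≡-Reasoning
  x = suc (2 ℕ.* m) C m

-- Absorption is used twice, to go down from row 2m + 2 to row 2m; in between, the symmetry of row
-- 2m + 1 moves the lower index from m to m + 1, which restores the factor m + 1.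
central-recurrence : ∀ m → suc m ℕ.* central (suc m) ≡ 2 ℕ.* suc (2 ℕ.* m) ℕ.* central m
central-recurrence m = begin
  suc m ℕ.* central (suc m)               ≡⟨ ≡.cong (λ u → suc m ℕ.* (u C suc m)) (2*suc m) ⟩
  suc m ℕ.* (suc (suc (2 ℕ.* m)) C suc m) ≡⟨ absorption (suc (2 ℕ.* m)) m ⟩
  suc (suc (2 ℕ.* m)) ℕ.* y               ≡⟨ ≡.cong (ℕ._* y) (2*suc m) ⟨
  2 ℕ.* suc m ℕ.* y                       ≡⟨ ≡.cong (2 ℕ.* suc m ℕ.*_) ([1+2m]C[1+m]≡[1+2m]Cm m) ⟨
  2 ℕ.* suc m ℕ.* z                       ≡⟨ ℕ.*-assoc 2 (suc m) z ⟩
  2 ℕ.* (suc m ℕ.* z)                     ≡⟨ ≡.cong (2 ℕ.*_) (absorption (2 ℕ.* m) m) ⟩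
  2 ℕ.* (suc (2 ℕ.* m) ℕ.* central m)     ≡⟨ ℕ.*-assoc 2 (suc (2 ℕ.* m)) (central m) ⟨
  2 ℕ.* suc (2 ℕ.* m) ℕ.* central m       ∎
  where
  open ≡.≡-Reasoning
  y = suc (2 ℕ.* m) C m
  z = suc (2 ℕ.* m) C suc m

-- By absorption p divides k (p C k), and k is coprime to p.
prime∣binomial : ∀ {p} → Prime p → ∀ k .{{_ : NonZero k}} → k < p → p ∣ p C k
prime∣binomial {suc q} pr (suc k) k<p =
  coprime-divisor (prime⇒coprime pr k<p) (≡.subst (suc q ∣_) (≡.sym (absorption q k)) (m∣m*n (q C k)))

-- Finite sums and truncated power series.

module FiniteSums {c ℓ} (R : CommutativeRing c ℓ) where

  open CommutativeRing R
  open IntegerCoefficients R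
  open Algebra.Properties.CommutativeSemiring.Exp commutativeSemiring
  open Relation.Binary.Reasoning.Setoid setoid

  ∑ : ℕ → (ℕ → Carrier) → Carrier
  ∑ zero    f = 0#
  ∑ (suc n) f = ∑ n f + f n

  ∑-cong : ∀ n {f g} → (∀ k → k < n → f k ≈ g k) → ∑ n f ≈ ∑ n g
  ∑-cong zero    f≈g = refl
  ∑-cong (suc n) f≈g = +-cong (∑-cong n (λ k k<n → f≈g k (ℕ.m<n⇒m<1+n k<n))) (f≈g n (ℕ.n<1+n n))

  ∑-+ : ∀ n f g → ∑ n (λ k → f k + g k) ≈ ∑ n f + ∑ n g
  ∑-+ zero    f g = sym (+-identityˡ 0#)
  ∑-+ (suc n) f g = trans (+-congʳ (∑-+ n f g))
    (solve 4 (λ a b c d → (a :+ b) :+ (c :+ d) := (a :+ c) :+ (b :+ d)) refl _ _ _ _)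

  ∑-* : ∀ n x f → ∑ n (λ k → x * f k) ≈ x * ∑ n f
  ∑-* zero    x f = sym (zeroʳ x)
  ∑-* (suc n) x f = trans (+-congʳ (∑-* n x f)) (sym (distribˡ x _ _))

  ∑-zero : ∀ n → ∑ n (λ _ → 0#) ≈ 0#
  ∑-zero zero    = refl
  ∑-zero (suc n) = trans (+-identityʳ _) (∑-zero n)

  ∑-head : ∀ n f → ∑ (suc n) f ≈ f 0 + ∑ n (λ k → f (suc k))
  ∑-head zero    f = trans (+-identityˡ _) (sym (+-identityʳ _))
  ∑-head (suc n) f = trans (+-congʳ (∑-head n f)) (+-assoc _ _ _)

  ∑-append : ∀ m n f → ∑ (m ℕ.+ n) f ≈ ∑ m f + ∑ n (λ k → f (m ℕ.+ k))
  ∑-append m zero    f rewrite ℕ.+-identityʳ m = sym (+-identityʳ _)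
  ∑-append m (suc n) f rewrite ℕ.+-suc m n = trans (+-congʳ (∑-append m n f)) (+-assoc _ _ _)

  ∑-even-odd : ∀ n f → ∑ (2 ℕ.* n) f ≈ ∑ n (λ k → f (2 ℕ.* k)) + ∑ n (λ k → f (suc (2 ℕ.* k)))
  ∑-even-odd zero    f = sym (+-identityˡ 0#)
  ∑-even-odd (suc n) f rewrite ℕ.+-suc n (n ℕ.+ 0) = trans (+-congʳ (+-congʳ (∑-even-odd n f)))
    (solve 4 (λ a b c d → ((a :+ b) :+ c) :+ d := (a :+ c) :+ (b :+ d)) refl _ _ _ _)

  series : (ℕ → ℕ) → ℕ → Carrier → Carrier
  series a n x = ∑ n (λ k → ι (+ a k) * x ^ k)

  series-cong : ∀ a n {x y} → x ≈ y → series a n x ≈ series a n y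
  series-cong a n x≈y = ∑-cong n (λ k _ → *-congˡ (^-congˡ k x≈y))

  1^ : ∀ k → 1# ^ k ≈ 1#
  1^ zero    = refl
  1^ (suc k) = trans (*-identityˡ _) (1^ k)

  ^-double : ∀ x k → x ^ (2 ℕ.* k) ≈ (x * x) ^ k
  ^-double x k = trans (sym (^-assocʳ x 2 k)) (^-congˡ k (*-congˡ (*-identityʳ x)))

  series-even-odd : ∀ a n x →
    series a (2 ℕ.* n) x ≈ series (λ k → a (2 ℕ.* k)) n (x * x) + x * series (λ k → a (suc (2 ℕ.* k))) n (x * x)
  series-even-odd a n x = trans (∑-even-odd n _) (+-cong
    (∑-cong n (λ k _ → *-congˡ (^-double x k)))
    (trans (∑-cong n (λ k _ → trans (*-congˡ (*-congˡ (^-double x k)))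
             (solve 3 (λ a x y → a :* (x :* y) := x :* (a :* y)) refl _ _ _)))
           (∑-* n x _)))

  -- The free bound `N` lets row n, padded with zeros, be summed over the same range k < p as the
  -- central coefficients.
  binomial-theorem : ∀ n {N} x → n < N → series (n C_) N x ≈ (1# + x) ^ n
  binomial-theorem zero    {suc N} x _ = begin
    series (0 C_) (suc N) x
      ≈⟨ ∑-head N _ ⟩
    1# * 1# + ∑ N (λ k → 0# * x ^ suc k)
      ≈⟨ +-cong (*-identityˡ 1#) (trans (∑-cong N (λ k _ → zeroˡ _)) (∑-zero N)) ⟩
    1# + 0#
      ≈⟨ +-identityʳ 1# ⟩
    1# ∎
  binomial-theorem (suc n) {suc N} x (s≤s n<N) = begin
    series (suc n C_) (suc N) x
      ≈⟨ ∑-head N _ ⟩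
    1# * 1# + ∑ N (λ k → ι (+ (suc n C suc k)) * (x * x ^ k))
      ≈⟨ +-congˡ (∑-cong N (λ k _ → pascal k)) ⟩
    1# * 1# + ∑ N (λ k → x * (ι (+ (n C k)) * x ^ k) + ι (+ (n C suc k)) * (x * x ^ k))
      ≈⟨ +-congˡ (trans (∑-+ N _ _) (+-congʳ (∑-* N x _))) ⟩
    1# * 1# + (x * series (n C_) N x + ∑ N (λ k → ι (+ (n C suc k)) * (x * x ^ k)))
      ≈⟨ solve 3 (λ a b c → a :+ (b :+ c) := b :+ (a :+ c)) refl _ _ _ ⟩
    x * series (n C_) N x + (1# * 1# + ∑ N (λ k → ι (+ (n C suc k)) * (x * x ^ k)))
      ≈⟨ +-cong (*-congˡ (binomial-theorem n x n<N)) (trans (sym (∑-head N _)) (binomial-theorem n x (ℕ.m<n⇒m<1+n n<N))) ⟩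
    x * (1# + x) ^ n + (1# + x) ^ n
      ≈⟨ solve 2 (λ x y → x :* y :+ y := (con (+ 1) :+ x) :* y) refl x _ ⟩
    (1# + x) ^ suc n ∎
    where
    pascal : ∀ k → ι (+ (suc n C suc k)) * (x * x ^ k) ≈ x * (ι (+ (n C k)) * x ^ k) + ι (+ (n C suc k)) * (x * x ^ k)
    pascal k = begin
      ι (+ (suc n C suc k)) * (x * x ^ k)
        ≈⟨ *-congʳ (trans (ι-cong (≡.cong +_ (≡.sym (nCk+nC[k+1]≡[n+1]C[k+1] n k)))) (ι-homo-+ (+ (n C k)) (+ (n C suc k)))) ⟩
      (ι (+ (n C k)) + ι (+ (n C suc k))) * (x * x ^ k)
        ≈⟨ solve 4 (λ a b x y → (a :+ b) :* (x :* y) := x :* (a :* y) :+ b :* (x :* y)) refl _ _ x _ ⟩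
      x * (ι (+ (n C k)) * x ^ k) + ι (+ (n C suc k)) * (x * x ^ k) ∎

-- Commutative rings in which p = 0: Frobenius and central binomial coefficients.

module CharacteristicP {c ℓ} (R : CommutativeRing c ℓ) {p : ℕ} (prime : Prime p)
  (p≈0 : CommutativeRing._≈_ R (IntegerCoefficients.ι R (+ p)) (CommutativeRing.0# R)) where

  open CommutativeRing R
  open IntegerCoefficients R
  open FiniteSums R
  open Algebra.Properties.CommutativeSemiring.Exp commutativeSemiring
  open Relation.Binary.Reasoning.Setoid setoid

  ι[m*n] : ∀ m n → ι (+ (m ℕ.* n)) ≈ ι (+ m) * ι (+ n)
  ι[m*n] m n = trans (ι-cong (ℤ.pos-* m n)) (ι-homo-* (+ m) (+ n))

  ι[1+n] : ∀ n → ι (+ suc n) ≈ 1# + ι (+ n)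
  ι[1+n] n = ι-homo-+ (+ 1) (+ n)

  p∣n⇒n≈0 : ∀ {n} → p ∣ n → ι (+ n) ≈ 0#
  p∣n⇒n≈0 (divides q ≡.refl) = trans (ι[m*n] q p) (trans (*-congˡ p≈0) (zeroʳ _))

  -- `R` may have zero divisors, but Bézout's identity makes the image of k a unit: its inverse is
  -- -v or v according to the sign in the identity.
  coprime-cancel₀ : ∀ {k} → Coprime p k → ∀ x → ι (+ k) * x ≈ 0# → x ≈ 0#
  coprime-cancel₀ {k} coprime x kx≈0 with coprime-Bézout coprime
  ... | Bézout.+- u v 1+vk≡up = begin
    x                         ≈⟨ solve 3 (λ v k x → x := (con (+ 1) :+ v :* k) :* x :- v :* (k :* x)) refl (ι (+ v)) (ι (+ k)) x ⟩
    (1# + ι (+ v) * ι (+ k)) * x - ι (+ v) * (ι (+ k) * x)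
      ≈⟨ +-cong (*-congʳ (trans (+-congˡ (sym (ι[m*n] v k))) (trans (sym (ι[1+n] (v ℕ.* k))) (p∣n⇒n≈0 (divides u 1+vk≡up))))) (-‿cong (*-congˡ kx≈0)) ⟩
    0# * x - ι (+ v) * 0#     ≈⟨ solve 2 (λ x v → con (+ 0) :* x :- v :* con (+ 0) := con (+ 0)) refl x (ι (+ v)) ⟩
    0#                        ∎
  ... | Bézout.-+ u v 1+up≡vk = begin
    x                         ≈⟨ solve 2 (λ x w → x := (con (+ 1) :+ w) :* x :- w :* x) refl x (ι (+ (u ℕ.* p))) ⟩
    (1# + ι (+ (u ℕ.* p))) * x - ι (+ (u ℕ.* p)) * x
      ≈⟨ +-cong (*-congʳ (trans (sym (ι[1+n] (u ℕ.* p))) (trans (ι-cong (≡.cong +_ 1+up≡vk)) (ι[m*n] v k)))) (-‿cong (*-congʳ (p∣n⇒n≈0 (divides u ≡.refl)))) ⟩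
    ι (+ v) * ι (+ k) * x - 0# * x
      ≈⟨ solve 3 (λ v k x → v :* k :* x :- con (+ 0) :* x := v :* (k :* x)) refl (ι (+ v)) (ι (+ k)) x ⟩
    ι (+ v) * (ι (+ k) * x)   ≈⟨ *-congˡ kx≈0 ⟩
    ι (+ v) * 0#              ≈⟨ zeroʳ _ ⟩
    0#                        ∎

  cancel : ∀ k .{{_ : NonZero k}} → k < p → ∀ x y → ι (+ k) * x ≈ ι (+ k) * y → x ≈ y
  cancel k k<p x y kx≈ky = begin
    x            ≈⟨ solve 2 (λ x y → x := (x :- y) :+ y) refl x y ⟩
    (x - y) + y  ≈⟨ +-congʳ (coprime-cancel₀ (prime⇒coprime prime k<p) (x - y) k[x-y]≈0) ⟩
    0# + y       ≈⟨ +-identityˡ y ⟩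
    y            ∎
    where
    k[x-y]≈0 = begin
      ι (+ k) * (x - y)           ≈⟨ solve 3 (λ k x y → k :* (x :- y) := k :* x :- k :* y) refl (ι (+ k)) x y ⟩
      ι (+ k) * x - ι (+ k) * y   ≈⟨ +-congʳ kx≈ky ⟩
      ι (+ k) * y - ι (+ k) * y   ≈⟨ -‿inverseʳ _ ⟩
      0#                          ∎

  frobenius : ∀ x y → (x + y) ^ p ≈ x ^ p + y ^ p
  frobenius x y = go p ≡.refl
    where
    open Algebra.Properties.CommutativeSemiring.Binomial commutativeSemiring using (theorem; binomialTerm)
    open Algebra.Properties.Semiring.Sum semiring
    open Algebra.Properties.Semiring.Mult semiring using (×-cong; ×-congʳ; ×-assoc-*) renaming (_×_ to _×ᵤ_)
    open Algebra.Properties.Semiring.Mult.TCOptimised semiring using (×ᵤ≈×)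

    multiple : ∀ n z → ι (+ n) ≈ 0# → n ×ᵤ z ≈ 0#
    multiple n z n≈0 = begin
      n ×ᵤ z          ≈⟨ ×-congʳ n (*-identityˡ z) ⟨
      n ×ᵤ (1# * z)   ≈⟨ ×-assoc-* n 1# z ⟨
      (n ×ᵤ 1#) * z   ≈⟨ *-congʳ (trans (×ᵤ≈× n 1#) n≈0) ⟩
      0# * z          ≈⟨ zeroˡ z ⟩
      0#              ∎

    go : ∀ r → r ≡ p → (x + y) ^ r ≈ x ^ r + y ^ r
    go zero    0≡p    = contradiction (≡.subst Prime (≡.sym 0≡p) prime) ¬prime[0]
    go (suc q) ≡.refl = begin
      (x + y) ^ suc q                                        ≈⟨ theorem (suc q) x y ⟩
      sum (binomialTerm x y (suc q))                         ≈⟨ +-congˡ (sum-init-last (λ k → binomialTerm x y (suc q) (Fin.suc k))) ⟩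
      term Fin.zero + (sum (λ k → term (Fin.suc (inject₁ k))) + term (fromℕ (suc q)))
        ≈⟨ +-cong first (+-cong (trans (sum-cong-≋ middle) (sum-replicate-zero q)) final) ⟩
      y ^ suc q + (0# + x ^ suc q)                           ≈⟨ solve 2 (λ x y → y :+ (con (+ 0) :+ x) := x :+ y) refl _ _ ⟩
      x ^ suc q + y ^ suc q                                  ∎
      where
      term = binomialTerm x y (suc q)
      first : term Fin.zero ≈ y ^ suc q
      first = trans (+-identityʳ _) (*-identityˡ _)
      middle : ∀ k → term (Fin.suc (inject₁ k)) ≈ 0#
      middle k rewrite Fin.toℕ-inject₁ k = multiple (suc q C suc (toℕ k)) _ (p∣n⇒n≈0 (prime∣binomial prime (suc (toℕ k)) (s≤s (Fin.toℕ<n k))))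
      final : term (fromℕ (suc q)) ≈ x ^ suc q
      final rewrite Fin.toℕ-fromℕ q =
        trans (×-cong (nCn≡1 (suc q)) (*-congˡ (^-congʳ y (ℕ.n∸n≡0 q)))) (trans (+-identityʳ _) (*-identityʳ _))

  ι[p+n]≈ι[n] : ∀ n → ι (+ (p ℕ.+ n)) ≈ ι (+ n)
  ι[p+n]≈ι[n] n = trans (ι-homo-+ (+ p) (+ n)) (trans (+-congʳ p≈0) (+-identityˡ _))

  -- From k to k + 1 the coefficient is multiplied by (p + k + 1) / (k + 1), which is 1 modulo p as
  -- long as k + 1 < p can be cancelled.
  [p+k]Ck≈1 : ∀ k → k < p → ι (+ ((p ℕ.+ k) C k)) ≈ 1#
  [p+k]Ck≈1 zero    _   = refl
  [p+k]Ck≈1 (suc k) k<p = cancel (suc k) k<p _ _ (begin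
    ι (+ suc k) * ι (+ ((p ℕ.+ suc k) C suc k))    ≈⟨ ι[m*n] (suc k) ((p ℕ.+ suc k) C suc k) ⟨
    ι (+ (suc k ℕ.* ((p ℕ.+ suc k) C suc k)))      ≈⟨ ι-cong (≡.cong +_ (≡.trans (≡.cong (λ u → suc k ℕ.* (u C suc k)) (ℕ.+-suc p k)) (absorption (p ℕ.+ k) k))) ⟩
    ι (+ (suc (p ℕ.+ k) ℕ.* ((p ℕ.+ k) C k)))      ≈⟨ ι[m*n] (suc (p ℕ.+ k)) ((p ℕ.+ k) C k) ⟩
    ι (+ suc (p ℕ.+ k)) * ι (+ ((p ℕ.+ k) C k))    ≈⟨ *-cong (trans (ι[1+n] (p ℕ.+ k)) (trans (+-congˡ (ι[p+n]≈ι[n] k)) (sym (ι[1+n] k)))) ([p+k]Ck≈1 k (ℕ.<-trans (ℕ.n<1+n k) k<p)) ⟩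
    ι (+ suc k) * 1#                               ∎)

  -- The recurrence says nothing at m + 1 = p, where both of its sides vanish, so this value has to
  -- be found separately. With p = q + 1, `central-suc` gives 2 C(p + q, q).
  central[p]≈2 : ι (+ central p) ≈ ι (+ 2)
  central[p]≈2 = go p ≡.refl
    where
    go : ∀ r → r ≡ p → ι (+ central r) ≈ ι (+ 2)
    go zero    0≡p  = contradiction (≡.subst Prime (≡.sym 0≡p) prime) ¬prime[0]
    go (suc q) ≡.refl = begin
      ι (+ central (suc q))                        ≡⟨ ≡.cong (λ m → ι (+ m)) (central-suc q) ⟩
      ι (+ (2 ℕ.* (suc (2 ℕ.* q) C q)))            ≈⟨ ι[m*n] 2 (suc (2 ℕ.* q) C q) ⟩
      ι (+ 2) * ι (+ (suc (2 ℕ.* q) C q))          ≡⟨ ≡.cong (λ m → ι (+ 2) * ι (+ (suc (q ℕ.+ m) C q))) (ℕ.+-identityʳ q) ⟩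
      ι (+ 2) * ι (+ ((p ℕ.+ q) C q))              ≈⟨ *-congˡ ([p+k]Ck≈1 q (ℕ.n<1+n q)) ⟩
      ι (+ 2) * 1#                                 ≈⟨ *-identityʳ _ ⟩
      ι (+ 2)                                      ∎

  central-step : ∀ m → ι (+ suc m) * ι (+ central (suc m)) ≈ ι (+ 2) * (1# + ι (+ 2) * ι (+ m)) * ι (+ central m)
  central-step m = begin
    ι (+ suc m) * ι (+ central (suc m))            ≈⟨ ι[m*n] (suc m) (central (suc m)) ⟨
    ι (+ (suc m ℕ.* central (suc m)))              ≡⟨ ≡.cong (λ k → ι (+ k)) (central-recurrence m) ⟩
    ι (+ (2 ℕ.* suc (2 ℕ.* m) ℕ.* central m))      ≈⟨ ι[m*n] (2 ℕ.* suc (2 ℕ.* m)) (central m) ⟩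
    ι (+ (2 ℕ.* suc (2 ℕ.* m))) * ι (+ central m)  ≈⟨ *-congʳ (trans (ι[m*n] 2 (suc (2 ℕ.* m))) (*-congˡ (trans (ι[1+n] (2 ℕ.* m)) (+-congˡ (ι[m*n] 2 m))))) ⟩
    ι (+ 2) * (1# + ι (+ 2) * ι (+ m)) * ι (+ central m) ∎

  -- The recurrences at p + i and at i coincide modulo p, and i + 1 < p can be cancelled; only the
  -- initial values differ, by the factor 2.
  central[p+i]≈2central[i] : ∀ i → i < p → ι (+ central (p ℕ.+ i)) ≈ ι (+ 2) * ι (+ central i)
  central[p+i]≈2central[i] zero    _   = begin
    ι (+ central (p ℕ.+ 0))   ≡⟨ ≡.cong (λ m → ι (+ central m)) (ℕ.+-identityʳ p) ⟩
    ι (+ central p)           ≈⟨ central[p]≈2 ⟩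
    ι (+ 2)                   ≈⟨ *-identityʳ _ ⟨
    ι (+ 2) * 1#              ∎
  central[p+i]≈2central[i] (suc i) i<p = cancel (suc i) i<p _ _ (begin
    ι (+ suc i) * ι (+ central (p ℕ.+ suc i))
      ≈⟨ *-cong (trans (ι[1+n] i) (trans (+-congˡ (sym (ι[p+n]≈ι[n] i))) (sym (ι[1+n] (p ℕ.+ i))))) (ι-cong (≡.cong (λ m → + central m) (ℕ.+-suc p i))) ⟩
    ι (+ suc (p ℕ.+ i)) * ι (+ central (suc (p ℕ.+ i)))
      ≈⟨ central-step (p ℕ.+ i) ⟩
    ι (+ 2) * (1# + ι (+ 2) * ι (+ (p ℕ.+ i))) * ι (+ central (p ℕ.+ i))
      ≈⟨ *-cong (*-congˡ (+-congˡ (*-congˡ (ι[p+n]≈ι[n] i)))) (central[p+i]≈2central[i] i (ℕ.<-trans (ℕ.n<1+n i) i<p)) ⟩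
    ι (+ 2) * (1# + ι (+ 2) * ι (+ i)) * (ι (+ 2) * ι (+ central i))
      ≈⟨ solve 3 (λ a i c → a :* (con (+ 1) :+ a :* i) :* (a :* c) := a :* (a :* (con (+ 1) :+ a :* i) :* c)) refl _ _ _ ⟩
    ι (+ 2) * (ι (+ 2) * (1# + ι (+ 2) * ι (+ i)) * ι (+ central i))
      ≈⟨ *-congˡ (central-step i) ⟨
    ι (+ 2) * (ι (+ suc i) * ι (+ central (suc i)))
      ≈⟨ solve 3 (λ a i c → a :* (i :* c) := i :* (a :* c)) refl _ _ _ ⟩
    ι (+ suc i) * (ι (+ 2) * ι (+ central (suc i))) ∎)

  module Odd (n : ℕ) (p≡1+2n : p ≡ suc (2 ℕ.* n)) where

    1+2n≈0 : 1# + ι (+ 2) * ι (+ n) ≈ 0#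
    1+2n≈0 = begin
      1# + ι (+ 2) * ι (+ n)   ≈⟨ +-congˡ (ι[m*n] 2 n) ⟨
      1# + ι (+ (2 ℕ.* n))     ≈⟨ ι[1+n] (2 ℕ.* n) ⟨
      ι (+ suc (2 ℕ.* n))      ≡⟨ ≡.cong (λ m → ι (+ m)) p≡1+2n ⟨
      ι (+ p)                  ≈⟨ p≈0 ⟩
      0#                       ∎

    n<p : n < p
    n<p = ≡.subst (n <_) (≡.sym p≡1+2n) (s≤s (ℕ.m≤m+n n _))

    -- Pascal's rule combined with absorption. The difference n - j is formed in `R`, so the formula
    -- also holds for j beyond n.
    binomial-step : ∀ j → ι (+ suc j) * ι (+ (n C suc j)) ≈ (ι (+ n) - ι (+ j)) * ι (+ (n C j))
    binomial-step j = begin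
      J′ * ι (+ (n C suc j))
        ≈⟨ solve 3 (λ a c c′ → a :* c′ := a :* (c :+ c′) :- a :* c) refl J′ c₀ _ ⟩
      J′ * (c₀ + ι (+ (n C suc j))) - J′ * c₀
        ≈⟨ +-congʳ (*-congˡ (sym (trans (ι-cong (≡.cong +_ (≡.sym (nCk+nC[k+1]≡[n+1]C[k+1] n j)))) (ι-homo-+ (+ (n C j)) (+ (n C suc j)))))) ⟩
      J′ * ι (+ (suc n C suc j)) - J′ * c₀
        ≈⟨ +-congʳ (trans (sym (ι[m*n] (suc j) (suc n C suc j))) (trans (ι-cong (≡.cong +_ (absorption n j))) (ι[m*n] (suc n) (n C j)))) ⟩
      ι (+ suc n) * c₀ - J′ * c₀
        ≈⟨ +-cong (*-congʳ (ι[1+n] n)) (-‿cong (*-congʳ (ι[1+n] j))) ⟩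
      (1# + ι (+ n)) * c₀ - (1# + ι (+ j)) * c₀
        ≈⟨ solve 3 (λ n j c → (con (+ 1) :+ n) :* c :- (con (+ 1) :+ j) :* c := (n :- j) :* c) refl (ι (+ n)) (ι (+ j)) c₀ ⟩
      (ι (+ n) - ι (+ j)) * c₀ ∎
      where
      J′ = ι (+ suc j)
      c₀ = ι (+ (n C j))

    central≈binomial : ∀ j → j < p → ι (+ central j) ≈ ι (+ (n C j)) * ι -[1+ 3 ] ^ j
    central≈binomial zero    _   = sym (*-identityʳ 1#)
    central≈binomial (suc j) j<p = cancel (suc j) j<p _ _ (begin
      ι (+ suc j) * ι (+ central (suc j))
        ≈⟨ central-step j ⟩
      ι (+ 2) * (1# + ι (+ 2) * J) * ι (+ central j)
        ≈⟨ *-congˡ (central≈binomial j (ℕ.<-trans (ℕ.n<1+n j) j<p)) ⟩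
      ι (+ 2) * (1# + ι (+ 2) * J) * (c₀ * w)
        -- This rests on 2 (1 + 2j) = -4 (n - j) + 2 (1 + 2n), whose last term is 2p and vanishes.
        ≈⟨ solve 4 (λ n j c w → con (+ 2) :* (con (+ 1) :+ con (+ 2) :* j) :* (c :* w)
             := (n :- j) :* c :* (con -[1+ 3 ] :* w) :+ (con (+ 1) :+ con (+ 2) :* n) :* (con (+ 2) :* c :* w)) refl N J c₀ w ⟩
      (N - J) * c₀ * (ι -[1+ 3 ] * w) + (1# + ι (+ 2) * N) * (ι (+ 2) * c₀ * w)
        ≈⟨ +-cong (*-congʳ (sym (binomial-step j))) (trans (*-congʳ 1+2n≈0) (zeroˡ _)) ⟩
      ι (+ suc j) * ι (+ (n C suc j)) * (ι -[1+ 3 ] * w) + 0#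
        ≈⟨ trans (+-identityʳ _) (*-assoc _ _ _) ⟩
      ι (+ suc j) * (ι (+ (n C suc j)) * (ι -[1+ 3 ] * w)) ∎)
      where
      N = ι (+ n)
      J = ι (+ j)
      c₀ = ι (+ (n C j))
      w = ι -[1+ 3 ] ^ j

    central-series : ∀ x → series central p x ≈ (1# + ι -[1+ 3 ] * x) ^ n
    central-series x = trans
      (∑-cong p (λ k k<p → trans (*-congʳ (central≈binomial k k<p))
        (trans (*-assoc _ _ _) (*-congˡ (sym (^-distrib-* (ι -[1+ 3 ]) x k))))))
      (binomial-theorem n (ι -[1+ 3 ] * x) n<p)

    -- The length is 2p because the sums of the theorem run over even indices 2k with k < p. The
    -- terms from p to 2p - 1 repeat the first p terms with the factor 2 x^p.
    central-series₂ : ∀ x → series central (2 ℕ.* p) x ≈ (1# + ι (+ 2) * x ^ p) * (1# + ι -[1+ 3 ] * x) ^ n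
    central-series₂ x = begin
      series central (2 ℕ.* p) x
        ≡⟨ ≡.cong (λ m → series central (p ℕ.+ m) x) (ℕ.+-identityʳ p) ⟩
      series central (p ℕ.+ p) x
        ≈⟨ ∑-append p p _ ⟩
      series central p x + ∑ p (λ k → ι (+ central (p ℕ.+ k)) * x ^ (p ℕ.+ k))
        ≈⟨ +-congˡ (trans (∑-cong p (λ k k<p → trans
             (*-cong (central[p+i]≈2central[i] k k<p) (^-homo-* x p k))
             (solve 4 (λ a b c d → a :* b :* (c :* d) := a :* c :* (b :* d)) refl _ _ _ _)))
             (∑-* p (ι (+ 2) * x ^ p) _)) ⟩
      series central p x + ι (+ 2) * x ^ p * series central p x
        ≈⟨ solve 2 (λ s y → s :+ y :* s := (con (+ 1) :+ y) :* s) refl _ _ ⟩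
      (1# + ι (+ 2) * x ^ p) * series central p x
        ≈⟨ *-congˡ (central-series x) ⟩
      (1# + ι (+ 2) * x ^ p) * (1# + ι -[1+ 3 ] * x) ^ n ∎

-- Even and odd parts of F, and the Catalan identity over adjoined roots.

evenCentral oddCentral : ℕ → ℕ
evenCentral k = central (2 ℕ.* k)
oddCentral  k = central (suc (2 ℕ.* k))

module Identities {c ℓ} (R : CommutativeRing c ℓ) {p : ℕ} (prime : Prime p)
  (p≈0 : CommutativeRing._≈_ R (IntegerCoefficients.ι R (+ p)) (CommutativeRing.0# R))
  (n : ℕ) (p≡1+2n : p ≡ suc (2 ℕ.* n)) where

  open CommutativeRing R
  open IntegerCoefficients R
  open FiniteSums R
  open CharacteristicP R prime p≈0
  open Odd n p≡1+2n
  open Algebra.Properties.CommutativeSemiring.Exp commutativeSemiring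
  open Algebra.Properties.Ring ring using (-‿distribˡ-*)
  open Relation.Binary.Reasoning.Setoid setoid

  -- This links the two kinds of powers: Frobenius controls exponent p, the Legendre symbol is an
  -- exponent n.
  ^p : ∀ x → x ^ p ≈ x * (x * x) ^ n
  ^p x = begin
    x ^ p                  ≡⟨ ≡.cong (x ^_) p≡1+2n ⟩
    x * x ^ (2 ℕ.* n)      ≈⟨ *-congˡ (^-assocʳ x 2 n) ⟨
    x * (x ^ 2) ^ n        ≈⟨ *-congˡ (^-congˡ n (*-congˡ (*-identityʳ x))) ⟩
    x * (x * x) ^ n        ∎

  -x*-x : ∀ x → (- x) * (- x) ≈ x * x
  -x*-x x = solve 1 (λ x → (:- x) :* (:- x) := x :* x) refl x

  [-x]^p : ∀ x → (- x) ^ p ≈ - (x ^ p)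
  [-x]^p x = begin
    (- x) ^ p                      ≈⟨ ^p (- x) ⟩
    (- x) * ((- x) * (- x)) ^ n    ≈⟨ *-congˡ (^-congˡ n (-x*-x x)) ⟩
    (- x) * (x * x) ^ n            ≈⟨ -‿distribˡ-* x _ ⟨
    - (x * (x * x) ^ n)            ≈⟨ -‿cong (^p x) ⟨
    - (x ^ p)                      ∎

  2^p≈2 : ι (+ 2) ^ p ≈ ι (+ 2)
  2^p≈2 = trans (frobenius 1# 1#) (+-cong (1^ p) (1^ p))

  even+odd : ∀ x → series evenCentral p (x * x) + x * series oddCentral p (x * x)
                   ≈ (1# + ι (+ 2) * x ^ p) * (1# - ι (+ 4) * x) ^ n
  even+odd x = begin
    series evenCentral p (x * x) + x * series oddCentral p (x * x)
      ≈⟨ series-even-odd central p x ⟨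
    series central (2 ℕ.* p) x
      ≈⟨ central-series₂ x ⟩
    (1# + ι (+ 2) * x ^ p) * (1# + ι -[1+ 3 ] * x) ^ n
      ≈⟨ *-congˡ (^-congˡ n (+-congˡ (sym (-‿distribˡ-* (ι (+ 4)) x)))) ⟩
    (1# + ι (+ 2) * x ^ p) * (1# - ι (+ 4) * x) ^ n ∎

  even-odd : ∀ x → series evenCentral p (x * x) - x * series oddCentral p (x * x)
                   ≈ (1# - ι (+ 2) * x ^ p) * (1# + ι (+ 4) * x) ^ n
  even-odd x = begin
    series evenCentral p (x * x) - x * series oddCentral p (x * x)
      ≈⟨ +-cong (series-cong evenCentral p (sym (-x*-x x)))
                (trans (-‿distribˡ-* x _) (*-congˡ (series-cong oddCentral p (sym (-x*-x x))))) ⟩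
    series evenCentral p ((- x) * (- x)) + (- x) * series oddCentral p ((- x) * (- x))
      ≈⟨ even+odd (- x) ⟩
    (1# + ι (+ 2) * (- x) ^ p) * (1# - ι (+ 4) * (- x)) ^ n
      ≈⟨ *-cong (+-congˡ (trans (*-congˡ ([-x]^p x)) (solve 2 (λ a y → a :* (:- y) := :- (a :* y)) refl _ _)))
                (^-congˡ n (+-congˡ (solve 2 (λ a y → :- (a :* (:- y)) := a :* y) refl _ _))) ⟩
    (1# - ι (+ 2) * x ^ p) * (1# + ι (+ 4) * x) ^ n ∎

  2*even : ∀ x → ι (+ 2) * series evenCentral p (x * x)
                 ≈ (1# + ι (+ 2) * x ^ p) * (1# - ι (+ 4) * x) ^ n + (1# - ι (+ 2) * x ^ p) * (1# + ι (+ 4) * x) ^ n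
  2*even x = trans (solve 2 (λ g h → con (+ 2) :* g := (g :+ h) :+ (g :- h)) refl _ (x * series oddCentral p (x * x)))
                   (+-cong (even+odd x) (even-odd x))

  -- a and b are square roots of 1 + t and 1 - t, so that 2 (1 ± ab) = (a ± b)².
  module _ {t h a b : Carrier} (a²≈1+t : a * a ≈ 1# + t) (b²≈1-t : b * b ≈ 1# - t) (2h≈1 : ι (+ 2) * h ≈ 1#) where

    private
      A B σ s : Carrier
      A = (1# + t) ^ n
      B = (1# - t) ^ n
      σ = a * b
      s = h * h * σ

    a^p : a ^ p ≈ a * A
    a^p = trans (^p a) (*-congˡ (^-congˡ n a²≈1+t))

    b^p : b ^ p ≈ b * B
    b^p = trans (^p b) (*-congˡ (^-congˡ n b²≈1-t))

    h^p≈h : h ^ p ≈ h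
    h^p≈h = begin
      h ^ p                          ≈⟨ *-identityʳ _ ⟨
      h ^ p * 1#                     ≈⟨ *-congˡ 2h≈1 ⟨
      h ^ p * (ι (+ 2) * h)          ≈⟨ *-congˡ (*-congʳ 2^p≈2) ⟨
      h ^ p * (ι (+ 2) ^ p * h)      ≈⟨ solve 3 (λ x y h → x :* (y :* h) := (y :* x) :* h) refl _ _ h ⟩
      (ι (+ 2) ^ p * h ^ p) * h      ≈⟨ *-congʳ (^-distrib-* (ι (+ 2)) h p) ⟨
      (ι (+ 2) * h) ^ p * h          ≈⟨ *-congʳ (^-congˡ p 2h≈1) ⟩
      1# ^ p * h                     ≈⟨ *-congʳ (1^ p) ⟩
      1# * h                         ≈⟨ *-identityˡ h ⟩
      h                              ∎

    4s≈σ : ι (+ 4) * s ≈ σ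
    4s≈σ = begin
      ι (+ 4) * (h * h * σ)                ≈⟨ solve 2 (λ h σ → con (+ 4) :* (h :* h :* σ) := (con (+ 2) :* h) :* ((con (+ 2) :* h) :* σ)) refl h σ ⟩
      (ι (+ 2) * h) * ((ι (+ 2) * h) * σ)  ≈⟨ *-cong 2h≈1 (*-congʳ 2h≈1) ⟩
      1# * (1# * σ)                        ≈⟨ trans (*-identityˡ _) (*-identityˡ σ) ⟩
      σ                                    ∎

    2s^p : ι (+ 2) * s ^ p ≈ h * (a * A * (b * B))
    2s^p = begin
      ι (+ 2) * (h * h * σ) ^ p                   ≈⟨ *-congˡ (trans (^-distrib-* (h * h) σ p) (*-cong (^-distrib-* h h p) (^-distrib-* a b p))) ⟩
      ι (+ 2) * (h ^ p * h ^ p * (a ^ p * b ^ p)) ≈⟨ *-congˡ (*-cong (*-cong h^p≈h h^p≈h) (*-cong a^p b^p)) ⟩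
      ι (+ 2) * (h * h * (a * A * (b * B)))       ≈⟨ solve 3 (λ c h y → c :* (h :* h :* y) := (c :* h) :* (h :* y)) refl _ h _ ⟩
      (ι (+ 2) * h) * (h * (a * A * (b * B)))     ≈⟨ trans (*-congʳ 2h≈1) (*-identityˡ _) ⟩
      h * (a * A * (b * B))                       ∎

    -- As y = h u² and (u²)^(n+1) = u u^p, Frobenius evaluates the exponent n + 1. Exponent n would
    -- require dividing by u², which need not be invertible.
    half-square : ∀ y u v → ι (+ 2) * y ≈ u * u → u ^ p ≈ v → y * y ^ n ≈ h ^ suc n * (u * v)
    half-square y u v 2y≈u² u^p≈v = begin
      y ^ suc n                          ≈⟨ ^-congˡ (suc n) (trans (sym (*-identityˡ y)) (trans (*-congʳ (sym 2h≈1)) (solve 3 (λ c h y → (c :* h) :* y := h :* (c :* y)) refl _ h y))) ⟩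
      (h * (ι (+ 2) * y)) ^ suc n        ≈⟨ ^-distrib-* h (ι (+ 2) * y) (suc n) ⟩
      h ^ suc n * (ι (+ 2) * y) ^ suc n  ≈⟨ *-congˡ (^-congˡ (suc n) 2y≈u²) ⟩
      h ^ suc n * (u * u * (u * u) ^ n)  ≈⟨ *-congˡ (trans (*-assoc u u _) (*-congˡ (trans (sym (^p u)) u^p≈v))) ⟩
      h ^ suc n * (u * v)                ∎

    [1+σ]^[1+n] : (1# + σ) * (1# + σ) ^ n ≈ h ^ suc n * ((a + b) * (a * A + b * B))
    [1+σ]^[1+n] = half-square (1# + σ) (a + b) _
      (begin
        ι (+ 2) * (1# + σ)                        ≈⟨ solve 3 (λ a b t → con (+ 2) :* (con (+ 1) :+ a :* b) := (con (+ 1) :+ t) :+ (con (+ 1) :- t) :+ con (+ 2) :* (a :* b)) refl a b t ⟩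
        (1# + t) + (1# - t) + ι (+ 2) * (a * b)   ≈⟨ +-congʳ (+-cong a²≈1+t b²≈1-t) ⟨
        a * a + b * b + ι (+ 2) * (a * b)         ≈⟨ solve 2 (λ a b → a :* a :+ b :* b :+ con (+ 2) :* (a :* b) := (a :+ b) :* (a :+ b)) refl a b ⟩
        (a + b) * (a + b)                         ∎)
      (trans (frobenius a b) (+-cong a^p b^p))

    [1-σ]^[1+n] : (1# - σ) * (1# - σ) ^ n ≈ h ^ suc n * ((a - b) * (a * A - b * B))
    [1-σ]^[1+n] = half-square (1# - σ) (a - b) _
      (begin
        ι (+ 2) * (1# - σ)                        ≈⟨ solve 3 (λ a b t → con (+ 2) :* (con (+ 1) :- a :* b) := (con (+ 1) :+ t) :+ (con (+ 1) :- t) :- con (+ 2) :* (a :* b)) refl a b t ⟩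
        (1# + t) + (1# - t) - ι (+ 2) * (a * b)   ≈⟨ +-congʳ (+-cong a²≈1+t b²≈1-t) ⟨
        a * a + b * b - ι (+ 2) * (a * b)         ≈⟨ solve 2 (λ a b → a :* a :+ b :* b :- con (+ 2) :* (a :* b) := (a :- b) :* (a :- b)) refl a b ⟩
        (a - b) * (a - b)                         ∎)
      (trans (frobenius a (- b)) (+-cong a^p (trans ([-x]^p b) (-‿cong b^p))))

    -- By 2 C_m = 4 b_m - b_{m+1} with m = 2k, the bracket on the left is twice the Catalan sum at
    -- s². The common factor ab stays, since it may be a zero divisor.
    ab*catalan : a * b * (ι (+ 4) * series evenCentral p (s * s) - series oddCentral p (s * s))
                 ≈ a * b * (ι (+ 2) * h ^ suc n * (ι (+ 2) * (A + B) - A * B * (A * (1# + t) + B * (1# - t))))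
    ab*catalan = begin
      σ * (ι (+ 4) * G - H)
        ≈⟨ *-congʳ 4s≈σ ⟨
      ι (+ 4) * s * (ι (+ 4) * G - H)
        -- The values F(-s) = G - sH and F(s) = G + sH are weighted by 1 + 4s and 1 - 4s. These
        -- weights produce the combination 4G - H and also raise the powers (1 ± 4s)^n to the
        -- exponent n + 1 required by `half-square`.
        ≈⟨ solve 3 (λ s g h → con (+ 4) :* s :* (con (+ 4) :* g :- h)
             := con (+ 2) :* ((con (+ 1) :+ con (+ 4) :* s) :* (g :- s :* h) :- (con (+ 1) :- con (+ 4) :* s) :* (g :+ s :* h))) refl s G H ⟩
      ι (+ 2) * ((1# + ι (+ 4) * s) * (G - s * H) - (1# - ι (+ 4) * s) * (G + s * H))
        ≈⟨ *-congˡ (+-cong (*-cong (+-congˡ 4s≈σ) (trans (even-odd s) (*-cong (+-congˡ (-‿cong 2s^p)) (^-congˡ n (+-congˡ 4s≈σ)))))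
                           (-‿cong (*-cong (+-congˡ (-‿cong 4s≈σ)) (trans (even+odd s) (*-cong (+-congˡ 2s^p) (^-congˡ n (+-congˡ (-‿cong 4s≈σ)))))))) ⟩
      ι (+ 2) * ((1# + σ) * ((1# - τ) * (1# + σ) ^ n) - (1# - σ) * ((1# + τ) * (1# - σ) ^ n))
        ≈⟨ solve 5 (λ x u y v τ → con (+ 2) :* (x :* ((con (+ 1) :- τ) :* u) :- y :* ((con (+ 1) :+ τ) :* v))
             := con (+ 2) :* ((con (+ 1) :- τ) :* (x :* u) :- (con (+ 1) :+ τ) :* (y :* v))) refl (1# + σ) _ (1# - σ) _ τ ⟩
      ι (+ 2) * ((1# - τ) * ((1# + σ) * (1# + σ) ^ n) - (1# + τ) * ((1# - σ) * (1# - σ) ^ n))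
        ≈⟨ *-congˡ (+-cong (*-congˡ [1+σ]^[1+n]) (-‿cong (*-congˡ [1-σ]^[1+n]))) ⟩
      ι (+ 2) * ((1# - τ) * (η * ((a + b) * (a * A + b * B))) - (1# + τ) * (η * ((a - b) * (a * A - b * B))))
        -- The products (a ± b)(aA ± bB) share the part a²A + b²B, which cancels except where
        -- multiplied by τ, itself a multiple of ab; their other parts are ± ab (A + B). Hence ab
        -- can be taken out. The factor 2h is kept together for the next step.
        ≈⟨ solve 6 (λ a b A B h η →
             let τ = h :* (a :* A :* (b :* B)) in
             con (+ 2) :* ((con (+ 1) :- τ) :* (η :* ((a :+ b) :* (a :* A :+ b :* B))) :- (con (+ 1) :+ τ) :* (η :* ((a :- b) :* (a :* A :- b :* B))))
             := a :* b :* (con (+ 2) :* η :* (con (+ 2) :* (A :+ B) :- (con (+ 2) :* h) :* (A :* B :* (A :* (a :* a) :+ B :* (b :* b)))))) refl a b A B h η ⟩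
      σ * (ι (+ 2) * η * (ι (+ 2) * (A + B) - (ι (+ 2) * h) * (A * B * (A * (a * a) + B * (b * b)))))
        ≈⟨ *-congˡ (*-congˡ (+-congˡ (-‿cong (trans (*-congʳ 2h≈1) (trans (*-identityˡ _) (*-congˡ (+-cong (*-congˡ a²≈1+t) (*-congˡ b²≈1-t)))))))) ⟩
      σ * (ι (+ 2) * η * (ι (+ 2) * (A + B) - A * B * (A * (1# + t) + B * (1# - t)))) ∎
      where
      G = series evenCentral p (s * s)
      H = series oddCentral p (s * s)
      τ = h * (a * A * (b * B))
      η = h ^ suc n

-- Ring homomorphisms, and descent of the Catalan identity to the ground ring.

module RingHomomorphism {c₁ ℓ₁ c₂ ℓ₂} (R : CommutativeRing c₁ ℓ₁) (S : CommutativeRing c₂ ℓ₂)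
  {φ : CommutativeRing.Carrier R → CommutativeRing.Carrier S}
  (isHom : IsRingHomomorphism (CommutativeRing.rawRing R) (CommutativeRing.rawRing S) φ) where

  private
    module R where
      open CommutativeRing R public
      open IntegerCoefficients R public
      open FiniteSums R public
      open Algebra.Properties.CommutativeSemiring.Exp commutativeSemiring public
    module S where
      open CommutativeRing S public
      open IntegerCoefficients S public
      open FiniteSums S public
      open Algebra.Properties.CommutativeSemiring.Exp commutativeSemiring public
  open IsRingHomomorphism isHom public

  φ-ι : ∀ m → φ (R.ι (+ m)) S.≈ S.ι (+ m)
  φ-ι zero          = 0#-homo
  φ-ι (suc zero)    = 1#-homo
  φ-ι (suc (suc m)) = S.trans (+-homo _ _) (S.+-cong (φ-ι (suc m)) 1#-homo)

  φ-^ : ∀ x k → φ (x R.^ k) S.≈ φ x S.^ k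
  φ-^ x zero    = 1#-homo
  φ-^ x (suc k) = S.trans (*-homo _ _) (S.*-congˡ (φ-^ x k))

  φ-series : ∀ a m x → φ (R.series a m x) S.≈ S.series a m (φ x)
  φ-series a zero    x = 0#-homo
  φ-series a (suc m) x = S.trans (+-homo _ _) (S.+-cong (φ-series a m x)
    (S.trans (*-homo _ _) (S.*-cong (φ-ι (a m)) (φ-^ x m))))

module CatalanSeries {c₁ ℓ₁ c₂ ℓ₂} (R : CommutativeRing c₁ ℓ₁) (S : CommutativeRing c₂ ℓ₂)
  {φ : CommutativeRing.Carrier R → CommutativeRing.Carrier S}
  (isHom : IsRingHomomorphism (CommutativeRing.rawRing R) (CommutativeRing.rawRing S) φ)
  {p : ℕ} (prime : Prime p)
  (p≈0 : CommutativeRing._≈_ R (IntegerCoefficients.ι R (+ p)) (CommutativeRing.0# R))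
  (n : ℕ) (p≡1+2n : p ≡ suc (2 ℕ.* n)) where

  open CommutativeRing R
  open IntegerCoefficients R
  open FiniteSums R
  open Identities R prime p≈0 n p≡1+2n using (^p)
  open Algebra.Properties.CommutativeSemiring.Exp commutativeSemiring
  open Relation.Binary.Reasoning.Setoid setoid
  private
    module S where
      open CommutativeRing S public
      open IntegerCoefficients S public
      open FiniteSums S public
      open Algebra.Properties.CommutativeSemiring.Exp (CommutativeRing.commutativeSemiring S) public
  open RingHomomorphism R S isHom
    renaming (+-homo to φ-+; *-homo to φ-*; -‿homo to φ-neg; 1#-homo to φ-1; 0#-homo to φ-0; ⟦⟧-cong to φ-cong)
    using (φ-ι; φ-^; φ-series)

  module _ (t h : Carrier) (2h≈1 : ι (+ 2) * h ≈ 1#) {a b : S.Carrier}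
    (a²≈1+t : a S.* a S.≈ φ (1# + t)) (b²≈1-t : b S.* b S.≈ φ (1# - t))
    (cancel-ab : ∀ x y → a S.* b S.* φ x S.≈ a S.* b S.* φ y → x ≈ y) where

    private
      A B x W₀ : Carrier
      A = (1# + t) ^ n
      B = (1# - t) ^ n
      x = (1# - t * t) * (h * h * (h * h))
      W₀ = ι (+ 2) * h ^ suc n * (ι (+ 2) * (A + B) - A * B * (A * (1# + t) + B * (1# - t)))

      s : S.Carrier
      s = φ h S.* φ h S.* (a S.* b)

      φ-1+t : φ (1# + t) S.≈ S.1# S.+ φ t
      φ-1+t = S.trans (φ-+ 1# t) (S.+-congʳ φ-1)

      φ-1-t : φ (1# - t) S.≈ S.1# S.- φ t
      φ-1-t = S.trans (φ-+ 1# (- t)) (S.+-cong φ-1 (φ-neg t))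

      φ-2* : ∀ x → φ (ι (+ 2) * x) S.≈ S.ι (+ 2) S.* φ x
      φ-2* x = S.trans (φ-* (ι (+ 2)) x) (S.*-congʳ (φ-ι 2))

      2φh≈1 : S.ι (+ 2) S.* φ h S.≈ S.1#
      2φh≈1 = S.trans (S.sym (φ-2* h)) (S.trans (φ-cong 2h≈1) φ-1)

      φx≈s² : φ x S.≈ s S.* s
      φx≈s² = S.trans (φ-cong (solve 2 (λ t h → (con (+ 1) :- t :* t) :* (h :* h :* (h :* h)) := (h :* h :* (h :* h)) :* ((con (+ 1) :+ t) :* (con (+ 1) :- t))) refl t h))
        (S.trans (φ-* _ _) (S.trans (S.*-cong
          (S.trans (φ-* _ _) (S.*-cong (φ-* h h) (φ-* h h)))
          (S.trans (φ-* _ _) (S.*-cong (S.sym a²≈1+t) (S.sym b²≈1-t))))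
          (S.solve 3 (λ h a b → (h S.:* h S.:* (h S.:* h)) S.:* ((a S.:* a) S.:* (b S.:* b))
             S.:= (h S.:* h S.:* (a S.:* b)) S.:* (h S.:* h S.:* (a S.:* b))) S.refl (φ h) a b)))

      φA : φ A S.≈ (S.1# S.+ φ t) S.^ n
      φA = S.trans (φ-^ (1# + t) n) (S.^-congˡ n φ-1+t)

      φB : φ B S.≈ (S.1# S.- φ t) S.^ n
      φB = S.trans (φ-^ (1# - t) n) (S.^-congˡ n φ-1-t)

      φ-W₀ : φ W₀ S.≈ S.ι (+ 2) S.* φ h S.^ suc n S.*
        (S.ι (+ 2) S.* ((S.1# S.+ φ t) S.^ n S.+ (S.1# S.- φ t) S.^ n)
          S.- (S.1# S.+ φ t) S.^ n S.* (S.1# S.- φ t) S.^ n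
              S.* ((S.1# S.+ φ t) S.^ n S.* (S.1# S.+ φ t) S.+ (S.1# S.- φ t) S.^ n S.* (S.1# S.- φ t)))
      φ-W₀ = S.trans (φ-* _ _) (S.*-cong
        (S.trans (φ-2* _) (S.*-congˡ (φ-^ h (suc n))))
        (S.trans (φ-+ _ _) (S.+-cong
          (S.trans (φ-2* _) (S.*-congˡ (S.trans (φ-+ A B) (S.+-cong φA φB))))
          (S.trans (φ-neg _) (S.-‿cong (S.trans (φ-* _ _) (S.*-cong
            (S.trans (φ-* A B) (S.*-cong φA φB))
            (S.trans (φ-+ _ _) (S.+-cong
              (S.trans (φ-* _ _) (S.*-cong φA φ-1+t))
              (S.trans (φ-* _ _) (S.*-cong φB φ-1-t)))))))))))

      pS≈0 : S.ι (+ p) S.≈ S.0#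
      pS≈0 = S.trans (S.sym (φ-ι p)) (S.trans (φ-cong p≈0) φ-0)

      φ-lhs : φ (ι (+ 4) * series evenCentral p x - series oddCentral p x)
              S.≈ S.ι (+ 4) S.* S.series evenCentral p (s S.* s) S.- S.series oddCentral p (s S.* s)
      φ-lhs = S.trans (φ-+ _ _) (S.+-cong
        (S.trans (φ-* _ _) (S.*-cong (φ-ι 4) (S.trans (φ-series evenCentral p x) (S.series-cong evenCentral p φx≈s²))))
        (S.trans (φ-neg _) (S.-‿cong (S.trans (φ-series oddCentral p x) (S.series-cong oddCentral p φx≈s²)))))

      -- Apart from the common factor ab, both sides of `ab*catalan` involve a and b only through
      -- their squares, so they are images of elements of `R`; `cancel-ab` then takes the place of a
      -- division by ab.
      descended : ι (+ 4) * series evenCentral p x - series oddCentral p x ≈ W₀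
      descended = cancel-ab _ _ (S.trans (S.*-congˡ φ-lhs) (S.trans
        (Identities.ab*catalan S prime pS≈0 n p≡1+2n (S.trans a²≈1+t φ-1+t) (S.trans b²≈1-t φ-1-t) 2φh≈1)
        (S.*-congˡ (S.sym φ-W₀))))

    -- For y = 1 ± t the hypotheses say y (y^n)² = y, which covers y = 0 as well. This turns AB (A
    -- (1 + t) + B (1 - t)) into B (1 + t) + A (1 - t), and subtraction from 2 (A + B) exchanges the
    -- signs.
    catalan-series : (1# + t) ^ p ≈ 1# + t → (1# - t) ^ p ≈ 1# - t →
      ι (+ 4) * series evenCentral p ((1# - t * t) * (h * h * (h * h))) - series oddCentral p ((1# - t * t) * (h * h * (h * h)))
      ≈ ι (+ 2) * h ^ suc n * ((1# - t) ^ n * (1# - t) + (1# + t) ^ n * (1# + t))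
    catalan-series [1+t]^p≈1+t [1-t]^p≈1-t = trans descended (*-congˡ (begin
      ι (+ 2) * (A + B) - A * B * (A * (1# + t) + B * (1# - t))
        ≈⟨ solve 3 (λ A B t → con (+ 2) :* (A :+ B) :- A :* B :* (A :* (con (+ 1) :+ t) :+ B :* (con (+ 1) :- t))
             := con (+ 2) :* (A :+ B) :- (B :* ((con (+ 1) :+ t) :* (A :* A)) :+ A :* ((con (+ 1) :- t) :* (B :* B)))) refl A B t ⟩
      ι (+ 2) * (A + B) - (B * ((1# + t) * (A * A)) + A * ((1# - t) * (B * B)))
        ≈⟨ +-congˡ (-‿cong (+-cong (*-congˡ (y*y^n*y^n [1+t]^p≈1+t)) (*-congˡ (y*y^n*y^n [1-t]^p≈1-t)))) ⟩
      ι (+ 2) * (A + B) - (B * (1# + t) + A * (1# - t))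
        ≈⟨ solve 3 (λ A B t → con (+ 2) :* (A :+ B) :- (B :* (con (+ 1) :+ t) :+ A :* (con (+ 1) :- t))
             := B :* (con (+ 1) :- t) :+ A :* (con (+ 1) :+ t)) refl A B t ⟩
      B * (1# - t) + A * (1# + t) ∎))
      where
      y*y^n*y^n : ∀ {y} → y ^ p ≈ y → y * (y ^ n * y ^ n) ≈ y
      y*y^n*y^n {y} y^p≈y = trans (*-congˡ (sym (^-distrib-* y y n))) (trans (sym (^p y)) y^p≈y)

-- Adjoining two square roots.

module AdjoinRoots {c ℓ} (R : CommutativeRing c ℓ) (d e : CommutativeRing.Carrier R) where

  open CommutativeRing R using (Carrier; _≈_; sym; trans)
  private
    module Q₁ = QuadraticExtension R d
    module Q₂ = QuadraticExtension Q₁.extension (Q₁.embed e)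
    module Q₂-hom = IsRingHomomorphism Q₂.embed-isRingHomomorphism

  ring : CommutativeRing c ℓ
  ring = Q₂.extension

  private module S = CommutativeRing ring

  φ : Carrier → S.Carrier
  φ x = Q₂.embed (Q₁.embed x)

  φ-isRingHomomorphism : IsRingHomomorphism (CommutativeRing.rawRing R) S.rawRing φ
  φ-isRingHomomorphism = Algebra.Morphism.Construct.Composition.isRingHomomorphism
    (λ {x} {y} {z} → S.trans {x} {y} {z}) Q₁.embed-isRingHomomorphism Q₂.embed-isRingHomomorphism

  √d √e : S.Carrier
  √d = Q₂.embed Q₁.√d
  √e = Q₂.√d

  √d*√d≈d : √d S.* √d S.≈ φ d
  √d*√d≈d = S.trans {√d S.* √d} {Q₂.embed (Q₁.√d E₁.* Q₁.√d)} {φ d}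
    (S.sym {Q₂.embed (Q₁.√d E₁.* Q₁.√d)} {√d S.* √d} (Q₂-hom.*-homo Q₁.√d Q₁.√d)) (Q₂-hom.⟦⟧-cong Q₁.√d*√d≈d)
    where module E₁ = CommutativeRing Q₁.extension

  √e*√e≈e : √e S.* √e S.≈ φ e
  √e*√e≈e = Q₂.√d*√d≈d

  private
    -- The coefficient of √d √e in the basis 1, √d, √e, √d √e.
    coordinate : S.Carrier → Carrier
    coordinate x = proj₂ (proj₂ x)

    coordinate-√d√e : ∀ x → coordinate (√d S.* √e S.* φ x) ≈ x
    coordinate-√d√e x = trans (proj₂ (proj₂ reorder)) (trans (proj₂ (Q₂.√d*x (√d S.* φ x)))
      (trans (proj₂ (proj₁ (S.sym {Q₂.embed (Q₁.√d E₁.* Q₁.embed x)} {√d S.* φ x} (Q₂-hom.*-homo Q₁.√d (Q₁.embed x))))) (Q₁.√d*x (Q₁.embed x))))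
      where
      module E₁ = CommutativeRing Q₁.extension
      reorder : √d S.* √e S.* φ x S.≈ √e S.* (√d S.* φ x)
      reorder = S.trans {√d S.* √e S.* φ x} {√e S.* √d S.* φ x} {√e S.* (√d S.* φ x)}
        (S.*-congʳ {φ x} {√d S.* √e} {√e S.* √d} (S.*-comm √d √e)) (S.*-assoc √e √d (φ x))

  √d√e-cancel : ∀ x y → √d S.* √e S.* φ x S.≈ √d S.* √e S.* φ y → x ≈ y
  √d√e-cancel x y eq = trans (sym (coordinate-√d√e x)) (trans (proj₂ (proj₂ eq)) (coordinate-√d√e y))

-- The integers modulo m.

infix 4 _≡_[mod_]
_≡_[mod_] : ℤ → ℤ → ℕ → Set
x ≡ y [mod m ] = + m ∣ℤ x ℤ.- y

ℤ/_ : ℕ → CommutativeRing _ _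
ℤ/ m = record
  { Carrier = ℤ ; _≈_ = λ x y → x ≡ y [mod m ] ; _+_ = ℤ._+_ ; _*_ = ℤ._*_ ; -_ = ℤ.-_ ; 0# = + 0 ; 1# = + 1
  ; isCommutativeRing = record
    { isRing = record
      { +-isAbelianGroup = record
        { isGroup = record
          { isMonoid = record
            { isSemigroup = record
              { isMagma = record
                { isEquivalence = record
                  { refl = λ {x} → reflexive {x} ≡.refl
                  ; sym = λ {x} {y} x≈y → by (solve 2 (λ x y → :- (x :- y) := y :- x) ≡.refl x y) (∣m⇒∣-m x≈y)
                  ; trans = λ {x} {y} {z} x≈y y≈z → by (solve 3 (λ x y z → (x :- y) :+ (y :- z) := x :- z) ≡.refl x y z) (∣m∣n⇒∣m+n x≈y y≈z) }
                ; ∙-cong = λ {x} {y} {u} {v} x≈y u≈v → by (solve 4 (λ x y u v → (x :- y) :+ (u :- v) := (x :+ u) :- (y :+ v)) ≡.refl x y u v) (∣m∣n⇒∣m+n x≈y u≈v) }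
              ; assoc = λ x y z → reflexive (ℤ.+-assoc x y z) }
            ; identity = (λ x → reflexive (ℤ.+-identityˡ x)) , (λ x → reflexive (ℤ.+-identityʳ x)) }
          ; inverse = (λ x → reflexive (ℤ.+-inverseˡ x)) , (λ x → reflexive (ℤ.+-inverseʳ x))
          ; ⁻¹-cong = λ {x} {y} x≈y → by (solve 2 (λ x y → :- (x :- y) := (:- x) :- (:- y)) ≡.refl x y) (∣m⇒∣-m x≈y) }
        ; comm = λ x y → reflexive (ℤ.+-comm x y) }
      ; *-cong = λ {x} {y} {u} {v} x≈y u≈v →
          by (solve 4 (λ x y u v → u :* (x :- y) :+ y :* (u :- v) := x :* u :- y :* v) ≡.refl x y u v)
             (∣m∣n⇒∣m+n (∣n⇒∣m*n u x≈y) (∣n⇒∣m*n y u≈v))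
      ; *-assoc = λ x y z → reflexive (ℤ.*-assoc x y z)
      ; *-identity = (λ x → reflexive (ℤ.*-identityˡ x)) , (λ x → reflexive (ℤ.*-identityʳ x))
      ; distrib = (λ x y z → reflexive (ℤ.*-distribˡ-+ x y z)) , (λ x y z → reflexive (ℤ.*-distribʳ-+ x y z)) }
    ; *-comm = λ x y → reflexive (ℤ.*-comm x y) } }
  where
  open +-*-Solver using (solve; _:=_; _:+_; _:*_; _:-_; :-_)
  by : ∀ {x y} → x ≡ y → + m ∣ℤ x → + m ∣ℤ y
  by ≡.refl m∣x = m∣x
  reflexive : ∀ {x y} → x ≡ y → x ≡ y [mod m ]
  reflexive {x} ≡.refl = by (≡.sym (ℤ.+-inverseʳ x)) (ℤ∣.divides (+ 0) ≡.refl)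


-- Fields with p elements: Fermat, root counting and Euler's criterion.

-- These conditions determine the field with p elements up to isomorphism, without fixing how it is
-- constructed.
record IsPrimeField {c ℓ} (F : CommutativeRing c ℓ) (p : ℕ) : Set (c Level.⊔ ℓ) where
  open CommutativeRing F
  open IntegerCoefficients F
  field
    prime      : Prime p
    p≈0        : ι (+ p) ≈ 0#
    ι-kernel   : ∀ m → ι (+ m) ≈ 0# → p ∣ m
    ι-surjective : ∀ x → ∃ λ m → x ≈ ι (+ m)

module PrimeField {c ℓ} (F : CommutativeRing c ℓ) {p : ℕ} .{{_ : NonZero p}} (isPrimeField : IsPrimeField F p) where

  open IsPrimeField isPrimeField
  open CommutativeRing F
  open IntegerCoefficients F
  open FiniteSums F using (1^)
  open CharacteristicP F prime p≈0
  open Algebra.Properties.CommutativeSemiring.Exp commutativeSemiring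
  open Algebra.Properties.Group +-group using (x∙y⁻¹≈ε⇒x≈y)
  open Relation.Binary.Reasoning.Setoid setoid

  ι≉0 : ∀ m .{{_ : NonZero m}} → m < p → ¬ (ι (+ m) ≈ 0#)
  ι≉0 m m<p m≈0 = >⇒∤ m<p (ι-kernel m m≈0)

  x≈y⇒x-y≈0 : ∀ {x y} → x ≈ y → x - y ≈ 0#
  x≈y⇒x-y≈0 {x} {y} x≈y = trans (+-congʳ x≈y) (-‿inverseʳ y)

  integral : ∀ x y → x * y ≈ 0# → x ≈ 0# ⊎ y ≈ 0#
  integral x y xy≈0 with ι-surjective x | ι-surjective y
  ... | m , x≈m | k , y≈k
    with euclidsLemma m k prime (ι-kernel (m ℕ.* k) (trans (ι[m*n] m k) (trans (sym (*-cong x≈m y≈k)) xy≈0)))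
  ...   | inj₁ p∣m = inj₁ (trans x≈m (p∣n⇒n≈0 p∣m))
  ...   | inj₂ p∣k = inj₂ (trans y≈k (p∣n⇒n≈0 p∣k))

  *-cancelˡ-nonZero : ∀ {x y z} → ¬ (x ≈ 0#) → x * y ≈ x * z → y ≈ z
  *-cancelˡ-nonZero {x} {y} {z} x≉0 xy≈xz =
    [ (λ x≈0 → contradiction x≈0 x≉0) , x∙y⁻¹≈ε⇒x≈y y z ]′ (integral x (y - z) (begin
      x * (y - z)      ≈⟨ solve 3 (λ x y z → x :* (y :- z) := x :* y :- x :* z) refl x y z ⟩
      x * y - x * z    ≈⟨ x≈y⇒x-y≈0 xy≈xz ⟩
      0#               ∎))

  0^ : ∀ q .{{_ : NonZero q}} → 0# ^ q ≈ 0#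
  0^ (suc q) = zeroˡ _

  fermat : ∀ x → x ^ p ≈ x
  fermat x with ι-surjective x
  ... | m , x≈m = trans (^-congˡ p x≈m) (trans (natural m) (sym x≈m))
    where
    natural : ∀ m → ι (+ m) ^ p ≈ ι (+ m)
    natural zero    = 0^ p
    natural (suc m) = begin
      ι (+ suc m) ^ p          ≈⟨ ^-congˡ p (ι[1+n] m) ⟩
      (1# + ι (+ m)) ^ p       ≈⟨ frobenius 1# (ι (+ m)) ⟩
      1# ^ p + ι (+ m) ^ p     ≈⟨ +-cong (1^ p) (natural m) ⟩
      1# + ι (+ m)             ≈⟨ ι[1+n] m ⟨
      ι (+ suc m)              ∎

  ι-% : ∀ i → ι i ≈ ι (+ (i %ℕ p))
  ι-% i = begin
    ι i                                              ≡⟨ ≡.cong ι (ℤ.a≡a%ℕn+[a/ℕn]*n i p) ⟩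
    ι (+ (i %ℕ p) ℤ.+ (i ℤ./ℕ p) ℤ.* + p)            ≈⟨ ι-homo-+ (+ (i %ℕ p)) ((i ℤ./ℕ p) ℤ.* + p) ⟩
    ι (+ (i %ℕ p)) + ι ((i ℤ./ℕ p) ℤ.* + p)          ≈⟨ +-congˡ (trans (ι-homo-* (i ℤ./ℕ p) (+ p)) (trans (*-congˡ p≈0) (zeroʳ _))) ⟩
    ι (+ (i %ℕ p)) + 0#                              ≈⟨ +-identityʳ _ ⟩
    ι (+ (i %ℕ p))                                   ∎

  private
    ι-injective-≤ : ∀ {a b} → a ≤ b → b < p → ι (+ a) ≈ ι (+ b) → a ≡ b
    ι-injective-≤ {a} a≤b b<p a≈b with ℕ.m≤n⇒∃[o]m+o≡n a≤b
    ... | zero  , ≡.refl = ≡.sym (ℕ.+-identityʳ a)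
    ... | suc d , ≡.refl = contradiction
      (begin
        ι (+ suc d)                          ≈⟨ solve 2 (λ a d → d := (a :+ d) :- a) refl (ι (+ a)) (ι (+ suc d)) ⟩
        (ι (+ a) + ι (+ suc d)) - ι (+ a)    ≈⟨ +-congʳ (ι-homo-+ (+ a) (+ suc d)) ⟨
        ι (+ (a ℕ.+ suc d)) - ι (+ a)        ≈⟨ x≈y⇒x-y≈0 (sym a≈b) ⟩
        0#                                   ∎)
      (ι≉0 (suc d) (ℕ.≤-<-trans (ℕ.m≤n+m (suc d) a) b<p))

  ι-injective-< : ∀ {a b} → a < p → b < p → ι (+ a) ≈ ι (+ b) → a ≡ b
  ι-injective-< {a} {b} a<p b<p a≈b with ℕ.≤-total a b
  ... | inj₁ a≤b = ι-injective-≤ a≤b b<p a≈b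
  ... | inj₂ b≤a = ≡.sym (ι-injective-≤ b≤a a<p (sym a≈b))

  -- The list c₀ ∷ … ∷ c_{d-1} ∷ [] stands for the monic polynomial c₀ + … + c_{d-1} X^{d-1} + X^d.
  evalMonic : List Carrier → Carrier → Carrier
  evalMonic []       x = 1#
  evalMonic (c ∷ cs) x = c + x * evalMonic cs x

  -- Horner's scheme: the quotient by X - a has as coefficients the values at a of the successive
  -- tails, and it is again monic.
  quotient : Carrier → List Carrier → List Carrier
  quotient a []             = []
  quotient a (c ∷ [])       = []
  quotient a (c ∷ c′ ∷ cs)  = evalMonic (c′ ∷ cs) a ∷ quotient a (c′ ∷ cs)

  length-quotient : ∀ a c cs → length (quotient a (c ∷ cs)) ≡ length cs
  length-quotient a c []        = ≡.refl
  length-quotient a c (c′ ∷ cs) = ≡.cong suc (length-quotient a c′ cs)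

  synthetic-division : ∀ a c cs x →
    evalMonic (c ∷ cs) x - evalMonic (c ∷ cs) a ≈ (x - a) * evalMonic (quotient a (c ∷ cs)) x
  synthetic-division a c []        x =
    solve 3 (λ a c x → (c :+ x :* con (+ 1)) :- (c :+ a :* con (+ 1)) := (x :- a) :* con (+ 1)) refl a c x
  synthetic-division a c (c′ ∷ cs) x = begin
    (c + x * f x) - (c + a * f a)        ≈⟨ solve 5 (λ a c x u v → (c :+ x :* u) :- (c :+ a :* v) := x :* (u :- v) :+ (x :- a) :* v) refl a c x (f x) (f a) ⟩
    x * (f x - f a) + (x - a) * f a      ≈⟨ +-congʳ (*-congˡ (synthetic-division a c′ cs x)) ⟩
    x * ((x - a) * q) + (x - a) * f a    ≈⟨ solve 4 (λ a x q v → x :* ((x :- a) :* q) :+ (x :- a) :* v := (x :- a) :* (v :+ x :* q)) refl a x q (f a) ⟩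
    (x - a) * (f a + x * q)              ∎
    where
    f = evalMonic (c′ ∷ cs)
    q = evalMonic (quotient a (c′ ∷ cs)) x

  1≉0 : ¬ (1# ≈ 0#)
  1≉0 = ι≉0 1 (ℕ.nonTrivial⇒n>1 p)
    where instance _ = prime⇒nonTrivial prime

  -- Dividing by X - x leaves the remaining roots as roots of the quotient, by integrality. Monic
  -- polynomials keep the degree visible as a length and reduce the base case to 1 ≉ 0.
  root-bound : ∀ cs xs → AllPairs (λ x y → ¬ (x ≈ y)) xs → All (λ x → evalMonic cs x ≈ 0#) xs → length xs ≤ length cs
  root-bound cs       []       _                _           = z≤n
  root-bound []       (x ∷ xs) _                (1≈0 ∷ _)   = contradiction 1≈0 1≉0
  root-bound (c ∷ cs) (x ∷ xs) (x≉xs ∷ distinct) (fx≈0 ∷ roots) =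
    s≤s (≡.subst (length xs ≤_) (length-quotient x c cs)
      (root-bound (quotient x (c ∷ cs)) xs distinct (All.zipWith descend (x≉xs , roots))))
    where
    descend : ∀ {y} → (¬ (x ≈ y)) × (evalMonic (c ∷ cs) y ≈ 0#) → evalMonic (quotient x (c ∷ cs)) y ≈ 0#
    descend {y} (x≉y , fy≈0) with integral (y - x) _ (trans (sym (synthetic-division x c cs y)) (x≈y⇒x-y≈0 (trans fy≈0 (sym fx≈0))))
    ... | inj₁ y-x≈0 = contradiction (sym (x∙y⁻¹≈ε⇒x≈y y x y-x≈0)) x≉y
    ... | inj₂ qy≈0  = qy≈0

  module _ (n : ℕ) (p≡1+2n : p ≡ suc (2 ℕ.* n)) where

    open Identities F prime p≈0 n p≡1+2n using (^p)

    n-nonZero : NonZero n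
    n-nonZero = ℕ.≢-nonZero (λ n≡0 → ¬prime[1] (≡.subst Prime (≡.trans p≡1+2n (≡.cong (λ m → suc (2 ℕ.* m)) n≡0)) prime))

    square^n≈1 : ∀ x → ¬ (x ≈ 0#) → (x * x) ^ n ≈ 1#
    square^n≈1 x x≉0 = *-cancelˡ-nonZero x≉0 (trans (sym (^p x)) (trans (fermat x) (sym (*-identityʳ x))))

    -- Otherwise y would be a root of X^n - 1 besides the n distinct roots 1², …, n².
    nonSquare^n≉1 : ∀ y → (∀ x → x < p → ¬ (y ≈ ι (+ x) * ι (+ x))) → ¬ (y ^ n ≈ 1#)
    nonSquare^n≉1 y nonSquare y^n≈1 = ℕ.<-irrefl ≡.refl (≡.subst₂ _≤_ (≡.cong suc (length-applyUpTo square n)) (length-X^m-1 n)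
      (root-bound (X^m-1 n) (y ∷ applyUpTo square n) (All.applyUpTo⁺₁ square n y≉square ∷ AllPairs.applyUpTo⁺₁ square n distinct)
        (root n y^n≈1 ∷ All.applyUpTo⁺₁ square n (λ {i} i<n → root n (square^n≈1 (ι (+ suc i)) (ι≉0 (suc i) (suc-i<p i<n)))))))
      where
      instance _ = n-nonZero

      square : ℕ → Carrier
      square i = ι (+ suc i) * ι (+ suc i)

      1+2n≤p : suc (2 ℕ.* n) ≤ p
      1+2n≤p = ℕ.≤-reflexive (≡.sym p≡1+2n)

      suc-i<p : ∀ {i} → i < n → suc i < p
      suc-i<p i<n = ℕ.≤-trans (s≤s (ℕ.≤-trans i<n (ℕ.m≤m+n n _))) 1+2n≤p

      y≉square : ∀ {i} → i < n → ¬ (y ≈ square i)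
      y≉square {i} i<n = nonSquare (suc i) (suc-i<p i<n)

      distinct : ∀ {i j} → i < j → j < n → ¬ (square i ≈ square j)
      distinct {i} {j} i<j j<n i²≈j² =
        [ (λ i-j≈0 → ℕ.<-irrefl (ℕ.suc-injective (ι-injective-< (suc-i<p (ℕ.<-trans i<j j<n)) (suc-i<p j<n) (x∙y⁻¹≈ε⇒x≈y _ _ i-j≈0))) i<j)
        -- The two roots cannot be opposite: (i + 1) + (j + 1) is at most 2n, which is less than p.
        , (λ i+j≈0 → ι≉0 (suc i ℕ.+ suc j)
            (ℕ.≤-trans (s≤s (ℕ.+-mono-≤ (ℕ.<-trans i<j j<n) (ℕ.≤-trans j<n (ℕ.m≤m+n n 0)))) 1+2n≤p)
            (trans (ι-homo-+ (+ suc i) (+ suc j)) i+j≈0))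
        ]′ (integral (u - v) (u + v) (begin
          (u - v) * (u + v)   ≈⟨ solve 2 (λ u v → (u :- v) :* (u :+ v) := u :* u :- v :* v) refl u v ⟩
          u * u - v * v       ≈⟨ x≈y⇒x-y≈0 i²≈j² ⟩
          0#                  ∎))
        where
        u = ι (+ suc i)
        v = ι (+ suc j)

      -- At m = 0 the polynomial X^m - 1 is zero, hence not monic; `[]` is a filler with the right
      -- length, and `root` asks for m > 0.
      X^m-1 : ℕ → List Carrier
      X^m-1 zero    = []
      X^m-1 (suc m) = - 1# ∷ replicate m 0#

      length-X^m-1 : ∀ m → length (X^m-1 m) ≡ m
      length-X^m-1 zero    = ≡.refl
      length-X^m-1 (suc m) = ≡.cong suc (length-replicate m)

      eval-X^m : ∀ m x → evalMonic (replicate m 0#) x ≈ x ^ m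
      eval-X^m zero    x = refl
      eval-X^m (suc m) x = trans (+-identityˡ _) (*-congˡ (eval-X^m m x))

      root : ∀ m .{{_ : NonZero m}} {x} → x ^ m ≈ 1# → evalMonic (X^m-1 m) x ≈ 0#
      root (suc m) {x} x^m≈1 = trans (+-congˡ (trans (*-congˡ (eval-X^m m x)) x^m≈1)) (-‿inverseˡ 1#)

    -- By Fermat (y^n)² = 1 for y ≉ 0, so y^n is 1 or -1 by integrality. The hypothesis at x = 0
    -- excludes y = 0.
    nonSquare^n≈-1 : ∀ y → (∀ x → x < p → ¬ (y ≈ ι (+ x) * ι (+ x))) → y ^ n ≈ - 1#
    nonSquare^n≈-1 y nonSquare =
      [ (λ y^n-1≈0 → contradiction (x∙y⁻¹≈ε⇒x≈y _ _ y^n-1≈0) (nonSquare^n≉1 y nonSquare))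
      , (λ y^n+1≈0 → begin
          y ^ n               ≈⟨ solve 1 (λ a → a := (a :+ con (+ 1)) :- con (+ 1)) refl (y ^ n) ⟩
          (y ^ n + 1#) - 1#   ≈⟨ +-congʳ y^n+1≈0 ⟩
          0# - 1#             ≈⟨ +-identityˡ _ ⟩
          - 1#                ∎)
      ]′ (integral (y ^ n - 1#) (y ^ n + 1#) (begin
        (y ^ n - 1#) * (y ^ n + 1#)    ≈⟨ solve 1 (λ a → (a :- con (+ 1)) :* (a :+ con (+ 1)) := a :* a :- con (+ 1)) refl (y ^ n) ⟩
        y ^ n * y ^ n - 1#             ≈⟨ x≈y⇒x-y≈0 (trans (sym (^-distrib-* y y n)) (square^n≈1 y y≉0)) ⟩
        0#                             ∎))
      where
      y≉0 : ¬ (y ≈ 0#)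
      y≉0 y≈0 = nonSquare 0 (ℕ.>-nonZero⁻¹ p) (trans y≈0 (sym (zeroˡ 0#)))

    -- The search in `legendreℤ` compares residues as natural numbers, whereas the power is taken in
    -- `F`. Residues below p are determined by their images, so the two views agree.
    euler-criterion : ∀ i → ι (legendreℤ i p) ≈ ι i ^ n
    euler-criterion i with i %ℕ p in i%p
    ... | zero = sym (trans (^-congˡ n (trans (ι-% i) (ι-cong (≡.cong +_ i%p)))) (0^ n {{n-nonZero}}))
    ... | r@(suc _) with any (λ x → ((x ℕ.* x) ℕ.% p) ℕ.≡ᵇ r) (upTo p) in isSquare
    ...   | true = sym (begin
      ι i ^ n                       ≈⟨ ^-congˡ n i≈x² ⟩
      (ι (+ x) * ι (+ x)) ^ n       ≈⟨ square^n≈1 (ι (+ x)) x≉0 ⟩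
      1#                            ∎)
      where
      witness : ∃ λ x → x ∈ upTo p × T (((x ℕ.* x) ℕ.% p) ℕ.≡ᵇ r)
      witness = find (any⁻ _ (upTo p) (≡.subst T (≡.sym isSquare) _))
      x = proj₁ witness
      i≈x² : ι i ≈ ι (+ x) * ι (+ x)
      i≈x² = begin
        ι i                          ≈⟨ ι-% i ⟩
        ι (+ (i %ℕ p))               ≡⟨ ≡.cong (λ m → ι (+ m)) (≡.trans i%p (≡.sym (ℕ.≡ᵇ⇒≡ ((x ℕ.* x) ℕ.% p) r (proj₂ (proj₂ witness))))) ⟩
        ι (+ ((x ℕ.* x) ℕ.% p))      ≈⟨ ι-% (+ (x ℕ.* x)) ⟨
        ι (+ (x ℕ.* x))              ≈⟨ ι[m*n] x x ⟩
        ι (+ x) * ι (+ x)            ∎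
      x≉0 : ¬ (ι (+ x) ≈ 0#)
      x≉0 x≈0 = ι≉0 r (≡.subst (_< p) i%p (ℤ.n%ℕd<d i p)) (begin
        ι (+ r)             ≡⟨ ≡.cong (λ m → ι (+ m)) i%p ⟨
        ι (+ (i %ℕ p))      ≈⟨ ι-% i ⟨
        ι i                 ≈⟨ i≈x² ⟩
        ι (+ x) * ι (+ x)   ≈⟨ *-congʳ x≈0 ⟩
        0# * ι (+ x)        ≈⟨ zeroˡ _ ⟩
        0#                  ∎)
    ...   | false = sym (nonSquare^n≈-1 (ι i) nonSquare)
      where
      nonSquare : ∀ x → x < p → ¬ (ι i ≈ ι (+ x) * ι (+ x))
      nonSquare x x<p i≈x² = ≡.subst T isSquare (any⁺ _ (lose (∈-upTo⁺ x<p) (ℕ.≡⇒≡ᵇ _ _ (≡.trans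
        (ι-injective-< (ℕ.m%n<n (x ℕ.* x) p) (ℤ.n%ℕd<d i p) (begin
          ι (+ ((x ℕ.* x) ℕ.% p))   ≈⟨ ι-% (+ (x ℕ.* x)) ⟨
          ι (+ (x ℕ.* x))           ≈⟨ ι[m*n] x x ⟩
          ι (+ x) * ι (+ x)         ≈⟨ i≈x² ⟨
          ι i                       ≈⟨ ι-% i ⟩
          ι (+ (i %ℕ p))            ∎))
        i%p))))

-- Reduction of rationals modulo p, and the two congruences.

-- Cross-multiplied form of b_m / (m + 1) = (4 b_m - b_{m+1}) / 2. The fraction on the left has
-- denominator p for m = p - 1, which occurs in the sum; the one on the right can always be reduced
-- modulo an odd p.
2*central≡[1+m]*2catalan : ∀ m → + central m ℤ.* + 2 ≡ (+ 4 ℤ.* + central m ℤ.- + central (suc m)) ℤ.* + suc m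
2*central≡[1+m]*2catalan m = ≡.sym (begin
  (+ 4 ℤ.* c ℤ.- c′) ℤ.* + suc m             ≡⟨ solve 3 (λ c c′ m → (con (+ 4) :* c :- c′) :* m := con (+ 4) :* c :* m :- m :* c′) ≡.refl c c′ (+ suc m) ⟩
  + 4 ℤ.* c ℤ.* + suc m ℤ.- + suc m ℤ.* c′   ≡⟨ ≡.cong₂ (λ u v → + 4 ℤ.* c ℤ.* u ℤ.- v) ≡.refl recurrence ⟩
  + 4 ℤ.* c ℤ.* (+ 1 ℤ.+ + m) ℤ.- + 2 ℤ.* (+ 1 ℤ.+ + 2 ℤ.* + m) ℤ.* c
    ≡⟨ solve 2 (λ c m → con (+ 4) :* c :* (con (+ 1) :+ m) :- con (+ 2) :* (con (+ 1) :+ con (+ 2) :* m) :* c := c :* con (+ 2)) ≡.refl c (+ m) ⟩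
  c ℤ.* + 2                                  ∎)
  where
  open ≡.≡-Reasoning
  open +-*-Solver using (solve; _:=_; _:+_; _:*_; _:-_; con)
  c = + central m
  c′ = + central (suc m)
  recurrence : + suc m ℤ.* c′ ≡ + 2 ℤ.* (+ 1 ℤ.+ + 2 ℤ.* + m) ℤ.* c
  recurrence = begin
    + suc m ℤ.* c′                                ≡⟨ ℤ.pos-* (suc m) (central (suc m)) ⟨
    + (suc m ℕ.* central (suc m))                 ≡⟨ ≡.cong +_ (central-recurrence m) ⟩
    + (2 ℕ.* suc (2 ℕ.* m) ℕ.* central m)         ≡⟨ ℤ.pos-* (2 ℕ.* suc (2 ℕ.* m)) (central m) ⟩
    + (2 ℕ.* suc (2 ℕ.* m)) ℤ.* c                 ≡⟨ ≡.cong (ℤ._* c) (ℤ.pos-* 2 (suc (2 ℕ.* m))) ⟩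
    + 2 ℤ.* (+ 1 ℤ.+ + (2 ℕ.* m)) ℤ.* c           ≡⟨ ≡.cong (λ u → + 2 ℤ.* (+ 1 ℤ.+ u) ℤ.* c) (ℤ.pos-* 2 m) ⟩
    + 2 ℤ.* (+ 1 ℤ.+ + 2 ℤ.* + m) ℤ.* c           ∎

module Reduction {c ℓ} (F : CommutativeRing c ℓ) {p : ℕ} .{{_ : NonZero p}} (isPrimeField : IsPrimeField F p) where

  open IsPrimeField isPrimeField
  open CommutativeRing F
  open IntegerCoefficients F
  open FiniteSums F
  open CharacteristicP F prime p≈0
  open PrimeField F isPrimeField
  open Algebra.Properties.CommutativeSemiring.Exp commutativeSemiring
  open Algebra.Properties.Ring ring using (-0#≈0#; -‿involutive; -‿distribˡ-*)
  open Relation.Binary.Reasoning.Setoid setoid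

  ι≈0⇒∣ : ∀ i → ι i ≈ 0# → p ∣ ℤ.∣ i ∣
  ι≈0⇒∣ (+ m)    m≈0  = ι-kernel m m≈0
  ι≈0⇒∣ -[1+ m ] -m≈0 = ι-kernel (suc m) (trans (sym (-‿involutive _)) (trans (-‿cong -m≈0) -0#≈0#))

  *-nonZero : ∀ {x y} → ¬ (x ≈ 0#) → ¬ (y ≈ 0#) → ¬ (x * y ≈ 0#)
  *-nonZero {x} {y} x≉0 y≉0 xy≈0 = [ x≉0 , y≉0 ]′ (integral x y xy≈0)

  -- The image of q in F is z; the fraction need not be in lowest terms.
  record Reduces (q : ℚ) (z : Carrier) : Set ℓ where
    constructor reduces
    field
      {num}   : ℤ
      {den-1} : ℕ
      q≃      : toℚᵘ q ≃ mkℚᵘ num den-1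
      den≉0   : ¬ (ι (+ suc den-1) ≈ 0#)
      num≈    : ι num ≈ z * ι (+ suc den-1)

  reduces-/ : ∀ i d z → ¬ (ι (+ suc d) ≈ 0#) → ι i ≈ z * ι (+ suc d) → Reduces (i ℚ./ suc d) z
  reduces-/ i d z = reduces (toℚᵘ-fromℚᵘ (mkℚᵘ i d))

  reduces-ι : ∀ i → Reduces (i ℚ./ 1) (ι i)
  reduces-ι i = reduces-/ i 0 (ι i) 1≉0 (sym (*-identityʳ _))

  reduces-≈ : ∀ {q z z′} → z ≈ z′ → Reduces q z → Reduces q z′
  reduces-≈ z≈z′ (reduces q≃ den≉0 num≈) = reduces q≃ den≉0 (trans num≈ (*-congʳ z≈z′))

  reduces-0 : Reduces ℚ.0ℚ 0#
  reduces-0 = reduces {num = + 0} {den-1 = 0} (*≡* ≡.refl) 1≉0 (sym (zeroˡ 1#))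

  reduces-1 : Reduces 1ℚ 1#
  reduces-1 = reduces {num = + 1} {den-1 = 0} (*≡* ≡.refl) 1≉0 (sym (*-identityˡ 1#))

  reduces-+ : ∀ {q r y z} → Reduces q y → Reduces r z → Reduces (q ℚ.+ r) (y + z)
  reduces-+ {q} {r} {y} {z} (reduces {a} {d} q≃ d≉0 a≈) (reduces {b} {e} r≃ e≉0 b≈) = reduces
    (ℚᵘ.≃-trans (toℚᵘ-homo-+ q r) (ℚᵘ.+-cong q≃ r≃))
    (λ de≈0 → *-nonZero d≉0 e≉0 (trans (sym (ι[m*n] (suc d) (suc e))) de≈0))
    (begin
      ι (a ℤ.* + suc e ℤ.+ b ℤ.* + suc d)             ≈⟨ trans (ι-homo-+ (a ℤ.* + suc e) (b ℤ.* + suc d)) (+-cong (ι-homo-* a (+ suc e)) (ι-homo-* b (+ suc d))) ⟩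
      ι a * E + ι b * D                               ≈⟨ +-cong (*-congʳ a≈) (*-congʳ b≈) ⟩
      y * D * E + z * E * D                           ≈⟨ solve 4 (λ y z d e → y :* d :* e :+ z :* e :* d := (y :+ z) :* (d :* e)) refl y z D E ⟩
      (y + z) * (D * E)                               ≈⟨ *-congˡ (ι[m*n] (suc d) (suc e)) ⟨
      (y + z) * ι (+ (suc d ℕ.* suc e))               ∎)
    where
    D = ι (+ suc d)
    E = ι (+ suc e)

  reduces-* : ∀ {q r y z} → Reduces q y → Reduces r z → Reduces (q ℚ.* r) (y * z)
  reduces-* {q} {r} {y} {z} (reduces {a} {d} q≃ d≉0 a≈) (reduces {b} {e} r≃ e≉0 b≈) = reduces
    (ℚᵘ.≃-trans (toℚᵘ-homo-* q r) (ℚᵘ.*-cong q≃ r≃))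
    (λ de≈0 → *-nonZero d≉0 e≉0 (trans (sym (ι[m*n] (suc d) (suc e))) de≈0))
    (begin
      ι (a ℤ.* b)                          ≈⟨ ι-homo-* a b ⟩
      ι a * ι b                            ≈⟨ *-cong a≈ b≈ ⟩
      y * D * (z * E)                      ≈⟨ solve 4 (λ y z d e → y :* d :* (z :* e) := (y :* z) :* (d :* e)) refl y z D E ⟩
      (y * z) * (D * E)                    ≈⟨ *-congˡ (ι[m*n] (suc d) (suc e)) ⟨
      (y * z) * ι (+ (suc d ℕ.* suc e))    ∎)
    where
    D = ι (+ suc d)
    E = ι (+ suc e)

  reduces-neg : ∀ {q z} → Reduces q z → Reduces (ℚ.- q) (- z)
  reduces-neg {q} {z} (reduces {a} q≃ d≉0 a≈) = reduces
    (ℚᵘ.≃-trans (toℚᵘ-homo‿- q) (ℚᵘ.-‿cong q≃)) d≉0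
    (trans (ι-homo-neg a) (trans (-‿cong a≈) (-‿distribˡ-* z _)))

  reduces-minus : ∀ {q r y z} → Reduces q y → Reduces r z → Reduces (q ℚ.- r) (y - z)
  reduces-minus q r = reduces-+ q (reduces-neg r)

  reduces-^ : ∀ {q z} → Reduces q z → ∀ k → Reduces (q ^ℚ k) (z ^ k)
  reduces-^ q zero    = reduces-1
  reduces-^ q (suc k) = reduces-* q (reduces-^ q k)

  reduces-∑ : ∀ n {f g} → (∀ k → Reduces (f k) (g k)) → Reduces (sumℚ n f) (∑ n g)
  reduces-∑ zero    f = reduces-0
  reduces-∑ (suc n) f = reduces-+ (reduces-∑ n f) (f n)

  lowestTerms-num : ∀ q {z} → Reduces q z → ι (ℚ.numerator q) ≈ z * ι (ℚ.denominator q)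
  lowestTerms-num (mkℚ i e _) {z} (reduces {a} {d} (*≡* eq) d≉0 a≈) = *-cancelˡ-nonZero d≉0 (begin
    D * ι i                 ≈⟨ trans (*-comm D (ι i)) (sym (ι-homo-* i (+ suc d))) ⟩
    ι (i ℤ.* + suc d)       ≡⟨ ≡.cong ι eq ⟩
    ι (a ℤ.* + suc e)       ≈⟨ trans (ι-homo-* a (+ suc e)) (*-congʳ a≈) ⟩
    z * D * E               ≈⟨ solve 3 (λ z d e → z :* d :* e := d :* (z :* e)) refl z D E ⟩
    D * (z * E)             ∎)
    where
    D = ι (+ suc d)
    E = ι (+ suc e)

  -- If p divided the reduced denominator, `lowestTerms-num` would make it divide the numerator too,
  -- against coprimality.
  lowestTerms-den : ∀ q {z} → Reduces q z → ¬ (ι (ℚ.denominator q) ≈ 0#)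
  lowestTerms-den q@(mkℚ i e coprime) {z} q↦z e≈0 = ¬prime[1] (≡.subst Prime (Coprimality.recompute coprime (p∣i , ι-kernel (suc e) e≈0)) prime)
    where
    p∣i : p ∣ ℤ.∣ i ∣
    p∣i = ι≈0⇒∣ i (trans (lowestTerms-num q q↦z) (trans (*-congˡ e≈0) (zeroʳ z)))

  reduces⇒≡[modℚ] : ∀ {q r y z} → Reduces q y → Reduces r z → y ≈ z → q ≡ r [modℚ p ]
  reduces⇒≡[modℚ] {q} {r} q↦y r↦z y≈z = ι≈0⇒∣ (ℚ.numerator (q ℚ.- r)) (trans (lowestTerms-num (q ℚ.- r) (reduces-minus q↦y r↦z))
    (trans (*-congʳ (x≈y⇒x-y≈0 y≈z)) (zeroˡ _)))

  inverse : ∀ x → ¬ (x ≈ 0#) → ∃ λ y → x * y ≈ 1#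
  inverse x x≉0 = go p ≡.refl
    where
    go : ∀ q → p ≡ q → ∃ λ y → x * y ≈ 1#
    -- The inverse is x^(p-2), by Fermat.
    go (suc (suc q)) p≡q = x ^ q , *-cancelˡ-nonZero x≉0 (begin
      x * (x * x ^ q)   ≡⟨ ≡.cong (x ^_) p≡q ⟨
      x ^ p             ≈⟨ fermat x ⟩
      x                 ≈⟨ *-identityʳ x ⟨
      x * 1#            ∎)
    go 1 p≡1 = contradiction (≡.subst Prime p≡1 prime) ¬prime[1]
    go 0 p≡0 = contradiction (≡.subst Prime p≡0 prime) ¬prime[0]

  InD⇒reduces : ∀ q → InD p q → ∃ (Reduces q)
  InD⇒reduces (mkℚ i d coprime) p∤d = ι i * y , reduces {num = i} {den-1 = d} (*≡* ≡.refl) d≉0 (begin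
    ι i                   ≈⟨ *-identityʳ _ ⟨
    ι i * 1#              ≈⟨ *-congˡ dy≈1 ⟨
    ι i * (D * y)         ≈⟨ solve 3 (λ i d y → i :* (d :* y) := i :* y :* d) refl (ι i) D y ⟩
    ι i * y * D           ∎)
    where
    D = ι (+ suc d)
    d≉0 : ¬ (D ≈ 0#)
    d≉0 d≈0 = p∤d (ι-kernel (suc d) d≈0)
    y = proj₁ (inverse D d≉0)
    dy≈1 : D * y ≈ 1#
    dy≈1 = proj₂ (inverse D d≉0)

  module _ (n : ℕ) (p≡1+2n : p ≡ suc (2 ℕ.* n)) where

    -- For q = a/b in lowest terms the symbol is that of ab, and ab = z b² in `F`; the n-th power of
    -- b² is 1.
    reduces-legendre : ∀ {q z} → Reduces q z → Reduces (legendreℚ q p) (z ^ n)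
    reduces-legendre {q} {z} q↦z = reduces-≈ (begin
      ι (legendreℤ (ℚ.numerator q ℤ.* ℚ.denominator q) p)   ≈⟨ euler-criterion n p≡1+2n (ℚ.numerator q ℤ.* ℚ.denominator q) ⟩
      ι (ℚ.numerator q ℤ.* ℚ.denominator q) ^ n             ≈⟨ ^-congˡ n (trans (ι-homo-* (ℚ.numerator q) (ℚ.denominator q)) (trans (*-congʳ (lowestTerms-num q q↦z)) (*-assoc z D D))) ⟩
      (z * (D * D)) ^ n                                     ≈⟨ ^-distrib-* z (D * D) n ⟩
      z ^ n * (D * D) ^ n                                   ≈⟨ *-congˡ (square^n≈1 n p≡1+2n D (lowestTerms-den q q↦z)) ⟩
      z ^ n * 1#                                            ≈⟨ *-identityʳ _ ⟩
      z ^ n                                                 ∎)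
      (reduces-ι (legendreℤ (ℚ.numerator q ℤ.* ℚ.denominator q) p))
      where D = ι (ℚ.denominator q)

    private
      2<p : 2 < p
      2<p = ≡.subst (2 <_) (≡.sym p≡1+2n) (s≤s (ℕ.*-monoʳ-≤ 2 (ℕ.>-nonZero⁻¹ n {{n-nonZero n p≡1+2n}})))

      2≉0 : ¬ (ι (+ 2) ≈ 0#)
      2≉0 = ι≉0 2 2<p

      ½ : Carrier
      ½ = proj₁ (inverse (ι (+ 2)) 2≉0)

      2*½≈1 : ι (+ 2) * ½ ≈ 1#
      2*½≈1 = proj₂ (inverse (ι (+ 2)) 2≉0)

      reduces-½ : Reduces (+ 1 ℚ./ 2) ½
      reduces-½ = reduces-/ (+ 1) 1 ½ 2≉0 (trans (sym 2*½≈1) (*-comm _ _))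

      1/16 : Carrier
      1/16 = ½ * ½ * (½ * ½)

      reduces-1/16 : Reduces (+ 1 ℚ./ 16) 1/16
      reduces-1/16 = reduces-≈
        (begin
          ½ * (½ * (½ * (½ * 1#)))   ≈⟨ solve 1 (λ h → h :* (h :* (h :* (h :* con (+ 1)))) := h :* h :* (h :* h)) refl ½ ⟩
          1/16                       ∎)
        -- The closed rational `(+ 1 ℚ./ 2) ^ℚ 4` evaluates to `+ 1 ℚ./ 16`.
        (reduces-^ reduces-½ 4)

    reduces-catalan : ∀ m → Reduces (catalan m) (½ * (ι (+ 4) * ι (+ central m) - ι (+ central (suc m))))
    reduces-catalan m = reduces {num = + 4 ℤ.* + central m ℤ.- + central (suc m)}
      (ℚᵘ.≃-trans (toℚᵘ-fromℚᵘ (mkℚᵘ (+ central m) m)) (*≡* (2*central≡[1+m]*2catalan m)))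
      2≉0
      (begin
        ι (+ 4 ℤ.* + central m ℤ.- + central (suc m))    ≈⟨ ι-homo-+ (+ 4 ℤ.* + central m) (ℤ.- + central (suc m)) ⟩
        ι (+ 4 ℤ.* + central m) + ι (ℤ.- + central (suc m)) ≈⟨ +-cong (ι-homo-* (+ 4) (+ central m)) (ι-homo-neg (+ central (suc m))) ⟩
        y                                                ≈⟨ *-identityˡ y ⟨
        1# * y                                           ≈⟨ *-congʳ 2*½≈1 ⟨
        ι (+ 2) * ½ * y                                  ≈⟨ solve 3 (λ c h y → c :* h :* y := h :* y :* c) refl (ι (+ 2)) ½ y ⟩
        ½ * y * ι (+ 2)                                  ∎)
      where y = ι (+ 4) * ι (+ central m) - ι (+ central (suc m))

    private
      -- The symbols of 1/2 and 2 agree. Thus the powers of 1/2 created by `half-square` become the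
      -- factor (2/p) of the theorem.
      ½^n≈2^n : ½ ^ n ≈ ι (+ 2) ^ n
      ½^n≈2^n = begin
        ½ ^ n                                  ≈⟨ *-identityʳ _ ⟨
        ½ ^ n * 1#                             ≈⟨ *-congˡ (square^n≈1 n p≡1+2n (ι (+ 2)) 2≉0) ⟨
        ½ ^ n * (ι (+ 2) * ι (+ 2)) ^ n        ≈⟨ ^-distrib-* ½ (ι (+ 2) * ι (+ 2)) n ⟨
        (½ * (ι (+ 2) * ι (+ 2))) ^ n          ≈⟨ ^-congˡ n (trans (solve 2 (λ c h → h :* (c :* c) := (c :* h) :* c) refl (ι (+ 2)) ½) (trans (*-congʳ 2*½≈1) (*-identityˡ _))) ⟩
        ι (+ 2) ^ n                            ∎

      ∑-catalan : ∀ x → ∑ p (λ k → ½ * (ι (+ 4) * ι (+ evenCentral k) - ι (+ oddCentral k)) * x ^ k)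
                        ≈ ½ * (ι (+ 4) * series evenCentral p x - series oddCentral p x)
      ∑-catalan x = begin
        ∑ p (λ k → ½ * (ι (+ 4) * ι (+ evenCentral k) - ι (+ oddCentral k)) * x ^ k)
          ≈⟨ ∑-cong p (λ k _ → solve 4 (λ h u v y → h :* (con (+ 4) :* u :- v) :* y := h :* con (+ 4) :* (u :* y) :+ (:- h) :* (v :* y)) refl ½ (ι (+ evenCentral k)) (ι (+ oddCentral k)) (x ^ k)) ⟩
        ∑ p (λ k → ½ * ι (+ 4) * (ι (+ evenCentral k) * x ^ k) + (- ½) * (ι (+ oddCentral k) * x ^ k))
          ≈⟨ trans (∑-+ p _ _) (+-cong (∑-* p (½ * ι (+ 4)) _) (∑-* p (- ½) _)) ⟩
        ½ * ι (+ 4) * series evenCentral p x + (- ½) * series oddCentral p x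
          ≈⟨ solve 3 (λ h u v → h :* con (+ 4) :* u :+ (:- h) :* v := h :* (con (+ 4) :* u :- v)) refl ½ _ _ ⟩
        ½ * (ι (+ 4) * series evenCentral p x - series oddCentral p x) ∎

    module _ {t : ℚ} {z : Carrier} (t↦z : Reduces t z) where

      private
        reduces-1+_ : ∀ {q y} → Reduces q y → Reduces (1ℚ ℚ.+ q) (1# + y)
        reduces-1+ q↦y = reduces-+ reduces-1 q↦y

        reduces-1-_ : ∀ {q y} → Reduces q y → Reduces (1ℚ ℚ.- q) (1# - y)
        reduces-1- q↦y = reduces-minus reduces-1 q↦y

        2t↦2z : Reduces (+ 2 ℚ./ 1 ℚ.* t) (ι (+ 2) * z)
        2t↦2z = reduces-* (reduces-ι (+ 2)) t↦z

        4t↦4z : Reduces (+ 4 ℚ./ 1 ℚ.* t) (ι (+ 4) * z)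
        4t↦4z = reduces-* (reduces-ι (+ 4)) t↦z

      catalan-congruence :
        sumℚ p (λ k → catalan (2 ℕ.* k) ℚ.* (((1ℚ ℚ.- t ℚ.* t) ℚ.* (+ 1 ℚ./ 16)) ^ℚ k))
        ≡ (+ 1 ℚ./ 2) ℚ.* legendreℚ (+ 2 ℚ./ 1) p
          ℚ.* (legendreℚ (1ℚ ℚ.- t) p ℚ.* (1ℚ ℚ.- t) ℚ.+ legendreℚ (1ℚ ℚ.+ t) p ℚ.* (1ℚ ℚ.+ t)) [modℚ p ]
      catalan-congruence = reduces⇒≡[modℚ]
        (reduces-∑ p (λ k → reduces-* (reduces-catalan (2 ℕ.* k)) (reduces-^ (reduces-* (reduces-1- (reduces-* t↦z t↦z)) reduces-1/16) k)))
        (reduces-* (reduces-* reduces-½ (reduces-legendre (reduces-ι (+ 2))))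
          (reduces-+ (reduces-* (reduces-legendre (reduces-1- t↦z)) (reduces-1- t↦z))
                     (reduces-* (reduces-legendre (reduces-1+ t↦z)) (reduces-1+ t↦z))))
        (begin
          ∑ p (λ k → ½ * (ι (+ 4) * ι (+ evenCentral k) - ι (+ oddCentral k)) * x ^ k)
            ≈⟨ ∑-catalan x ⟩
          ½ * (ι (+ 4) * series evenCentral p x - series oddCentral p x)
            ≈⟨ *-congˡ (CatalanSeries.catalan-series F ring′ φ-isRingHomomorphism prime p≈0 n p≡1+2n z ½ 2*½≈1
                 √d*√d≈d √e*√e≈e √d√e-cancel (fermat (1# + z)) (fermat (1# - z))) ⟩
          ½ * (ι (+ 2) * ½ ^ suc n * W)
            ≈⟨ solve 4 (λ c h u w → h :* (c :* (h :* u) :* w) := (c :* h) :* (h :* u :* w)) refl (ι (+ 2)) ½ (½ ^ n) W ⟩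
          ι (+ 2) * ½ * (½ * ½ ^ n * W)
            ≈⟨ trans (*-congʳ 2*½≈1) (*-identityˡ _) ⟩
          ½ * ½ ^ n * W
            ≈⟨ *-congʳ (*-congˡ ½^n≈2^n) ⟩
          ½ * ι (+ 2) ^ n * W ∎)
        where
        open AdjoinRoots F (1# + z) (1# - z) renaming (ring to ring′)
        x = (1# - z * z) * 1/16
        W = (1# - z) ^ n * (1# - z) + (1# + z) ^ n * (1# + z)

      central-congruence :
        sumℚ p (λ k → (+ ((4 ℕ.* k) C (2 ℕ.* k)) ℚ./ 1) ℚ.* (t ^ℚ (2 ℕ.* k)))
        ≡ (+ 1 ℚ./ 2) ℚ.* (legendreℚ (1ℚ ℚ.- (+ 4 ℚ./ 1) ℚ.* t) p ℚ.* (1ℚ ℚ.+ (+ 2 ℚ./ 1) ℚ.* t)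
                           ℚ.+ legendreℚ (1ℚ ℚ.+ (+ 4 ℚ./ 1) ℚ.* t) p ℚ.* (1ℚ ℚ.- (+ 2 ℚ./ 1) ℚ.* t)) [modℚ p ]
      central-congruence = reduces⇒≡[modℚ]
        (reduces-∑ p (λ k → reduces-* (reduces-ι (+ ((4 ℕ.* k) C (2 ℕ.* k)))) (reduces-^ t↦z (2 ℕ.* k))))
        (reduces-* reduces-½ (reduces-+
          (reduces-* (reduces-legendre (reduces-1- 4t↦4z)) (reduces-1+ 2t↦2z))
          (reduces-* (reduces-legendre (reduces-1+ 4t↦4z)) (reduces-1- 2t↦2z))))
        (begin
          ∑ p (λ k → ι (+ ((4 ℕ.* k) C (2 ℕ.* k))) * z ^ (2 ℕ.* k))
            ≈⟨ ∑-cong p (λ k _ → *-cong (ι-cong (≡.cong (λ m → + (m C (2 ℕ.* k))) (ℕ.*-assoc 2 2 k))) (^-double z k)) ⟩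
          series evenCentral p (z * z)
            ≈⟨ trans (*-congʳ 2*½≈1) (*-identityˡ _) ⟨
          ι (+ 2) * ½ * series evenCentral p (z * z)
            ≈⟨ solve 3 (λ c h g → c :* h :* g := h :* (c :* g)) refl (ι (+ 2)) ½ _ ⟩
          ½ * (ι (+ 2) * series evenCentral p (z * z))
            ≈⟨ *-congˡ (Identities.2*even F prime p≈0 n p≡1+2n z) ⟩
          ½ * ((1# + ι (+ 2) * z ^ p) * u + (1# - ι (+ 2) * z ^ p) * v)
            -- Here the argument of F is `z` itself, an element of the prime field, so Fermat
            -- replaces z^p and no root has to be adjoined.
            ≈⟨ *-congˡ (+-cong (*-congʳ (+-congˡ (*-congˡ (fermat z)))) (*-congʳ (+-congˡ (-‿cong (*-congˡ (fermat z)))))) ⟩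
          ½ * ((1# + ι (+ 2) * z) * u + (1# - ι (+ 2) * z) * v)
            ≈⟨ *-congˡ (+-cong (*-comm _ u) (*-comm _ v)) ⟩
          ½ * (u * (1# + ι (+ 2) * z) + v * (1# - ι (+ 2) * z)) ∎)
        where
        u = (1# - ι (+ 4) * z) ^ n
        v = (1# + ι (+ 4) * z) ^ n

-- The prime field ℤ/p and the conclusion.

ℤ/p-isPrimeField : ∀ {p} .{{_ : NonZero p}} → Prime p → IsPrimeField (ℤ/ p) p
ℤ/p-isPrimeField {p} p-prime = record
  { prime = p-prime
  ; p≈0 = from∣ (≡.subst (+ p ∣ℤ_) (≡.sym (ι≡id p)) ℤ∣.∣-refl)
  ; ι-kernel = λ m m≈0 → ℤ∣.∣⇒∣ᵤ (≡.subst (+ p ∣ℤ_) (≡.trans (ℤ.+-identityʳ _) (ι≡id m)) m≈0)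
  ; ι-surjective = λ x → x %ℕ p , ≡.subst (λ y → x ≡ y [mod p ]) (≡.sym (ι≡id (x %ℕ p))) (ℤ∣.divides (x ℤ./ℕ p) (x-x%p x))
  }
  where
  open IntegerCoefficients (ℤ/ p) using (ι)
  open +-*-Solver using (solve; _:=_; _:+_; _:-_)

  ι≡id : ∀ m → ι (+ m) ≡ + m
  ι≡id zero          = ≡.refl
  ι≡id (suc zero)    = ≡.refl
  ι≡id (suc (suc m)) = ≡.trans (≡.cong (ℤ._+ + 1) (ι≡id (suc m))) (≡.cong +_ (ℕ.+-comm (suc m) 1))

  from∣ : ∀ {x} → + p ∣ℤ x → x ≡ + 0 [mod p ]
  from∣ {x} = ≡.subst (+ p ∣ℤ_) (≡.sym (ℤ.+-identityʳ x))

  x-x%p : ∀ x → x ℤ.- + (x %ℕ p) ≡ (x ℤ./ℕ p) ℤ.* + p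
  x-x%p x = ≡.trans (≡.cong (ℤ._- + (x %ℕ p)) (ℤ.a≡a%ℕn+[a/ℕn]*n x p))
    (solve 2 (λ r m → (r :+ m) :- r := m) ≡.refl (+ (x %ℕ p)) ((x ℤ./ℕ p) ℤ.* + p))

odd-prime : ∀ {p} → Prime p → 2 < p → ∃ λ n → p ≡ suc (2 ℕ.* n)
odd-prime {p} p-prime 2<p with p ℕ.% 2 in p%2 | ℕ.m%n<n p 2
... | 0 | _ = contradiction (m%n≡0⇒n∣m p 2 p%2) 2∤p
  where
  2∤p : ¬ (2 ∣ p)
  2∤p 2∣p with prime⇒irreducible p-prime 2∣p
  ... | inj₂ ≡.refl = ℕ.<-irrefl ≡.refl 2<p
... | 1 | _ = p ℕ./ 2 , ≡.trans (ℕ.m≡m%n+[m/n]*n p 2) (≡.cong₂ ℕ._+_ p%2 (ℕ.*-comm (p ℕ./ 2) 2))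
... | suc (suc _) | s≤s (s≤s ())

open import Data.Rational using (_+_; _-_; _*_; _/_)

theorem9 : (p : ℕ) → .{{_ : NonZero p}} → Prime p → p > 3 → (t : ℚ) → InD p t →
    (sumℚ p (λ k → catalan (2 ℕ.* k) * (((1ℚ - t * t) * ((+ 1) / 16)) ^ℚ k))
    ≡ ((+ 1) / 2) * legendreℚ ((+ 2) / 1) p
    * (legendreℚ (1ℚ - t) p * (1ℚ - t) + legendreℚ (1ℚ + t) p * (1ℚ + t))
    [modℚ p ])
    ×
    (sumℚ p (λ k → ((+ ((4 ℕ.* k) C (2 ℕ.* k))) / 1) * (t ^ℚ (2 ℕ.* k)))
    ≡ ((+ 1) / 2)
    * (legendreℚ (1ℚ - ((+ 4) / 1) * t) p * (1ℚ + ((+ 2) / 1) * t)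
    + legendreℚ (1ℚ + ((+ 4) / 1) * t) p * (1ℚ - ((+ 2) / 1) * t))
    [modℚ p ])
theorem9 p p-prime p>3 t t∈D = catalan-congruence n p≡1+2n t↦z , central-congruence n p≡1+2n t↦z
  where
  open Reduction (ℤ/ p) (ℤ/p-isPrimeField p-prime)
  n = proj₁ (odd-prime p-prime (ℕ.<-trans (ℕ.n<1+n 2) p>3))
  p≡1+2n = proj₂ (odd-prime p-prime (ℕ.<-trans (ℕ.n<1+n 2) p>3))
  t↦z = proj₂ (InD⇒reduces t t∈D)
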